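{- Let $(G,L,v)$ be a reachable triple, $i\in[4]$ a color and $D\ge2$ an integer. Then: (1) $P(G,L,v,i,D)=0$ if and only if $\Pr_{G,L}[c(v)=i]=0$; (2) $P(G,L,v,i,D)=\frac12$ if and only if $\Pr_{G,L}[c(v)=i]=\frac12$; (3) $P(G,L,v,i,D)\in[\frac1{13},\frac{13}{27}]$ if and only if $\Pr_{G,L}[c(v)=i]\in[\frac1{13},\frac{13}{27}]$.
   Context: Colors are $[4]=\{1,2,3,4\}$. A list-coloring instance $(G,L)$ is a finite simple graph $G=(V,E)$ with $L:V\to 2^{[4]}$; a proper coloring is $c:V\to[4]$ with $c(u)\in L(u)$ for all $u$ and $c(u)\ne c(w)$ on every edge; $\Pr_{G,L}[c(v)=i]$ is the probability that $c(v)=i$ for $c$ uniform over proper colorings of $(G,L)$. For a vertex $v$, $G_v$ is $G$ with $v$ and its incident edges removed, and $G_{v,w}=(G_v)_w$. If $v$ has neighbors $v_1,\dots,v_d$ (in a fixed order), then for $k\in[d]$ and a color $j$, $L_{k,j}$ is the list assignment on $G_v$ with $L_{k,j}(v_\ell)=L(v_\ell)\setminus\{j\}$ for $\ell<k$ and $L_{k,j}(u)=L(u)$ for all other vertices $u$ (so $L_{1,j}=L$). A triple $(G,L,v)$ with $v\in V$ is reachable if $\deg_G(u)\le3$ and $|L(u)|\ge\deg_G(u)+1$ for every $u\in V$, and moreover $\deg_G(v)\le2$ and $|L(v)|\ge\deg_G(v)+2$. The procedure $P(G,L,v,i,D)$ ($i\in[4]$, $D$ an integer) is defined recursively (empty products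 equal $1$): (a) If $i\notin L(v)$, return $0$. Otherwise, if $D\le 0$ or $\deg_G(v)=0$, return $1/|L(v)|$. (b) If $\deg_G(v)=1$ with neighbor $v_1$: let $x=P(G_v,L,v_1,i,D-1)$. If $|L(v)|=2$, say $L(v)=\{i,j\}$, let $y=P(G_v,L,v_1,j,D-1)$ and return $\frac{1-x}{2-x-y}$. If $|L(v)|=4$, return $\frac{1-x}{3}$. If $|L(v)|=3$, let $j$ be the unique color in $[4]\setminus L(v)$, $y=P(G_v,L,v_1,j,D-1)$, and return $\frac{1-x}{2+y}$. (c) If $\deg_G(v)=2$: order its neighbors $v_1,v_2$ so that $\deg_G(v_1)\ge\deg_G(v_2)$ and, if $\deg_G(v_1)=\deg_G(v_2)=1$, so that $i\notin L(v_1)$ implies $i\notin L(v_2)$. Let $u_1,\dots,u_{d_1}$ be the neighbors of $v_1$ in $G_v$ (fixed order) and for $k\in[d_1]$, $w\in[4]$ let $L'_{k,w}$ be the list assignment on $G_{v,v_1}$ with $L'_{k,w}(u_\ell)=L(u_\ell)\setminus\{w\}$ for $\ell<k$ and $L'_{k,w}(u)=L(u)$ otherwise. Set $x_{k,w}=P(G_{v,v_1},L'_{k,w},u_k,w,D-1)$ for $k\in[d_1]$, $w\in L(v_1)$. For $j\in L(v)$ set $f_j=0$ if $j\notin L(v_1)$ and otherwise $f_j=\frac{\prod_{k=1}^{d_1}(1-x_{k,j})}{\sum_{w\in L(v_1)}\prod_{k=1}^{d_1}(1-x_{k,w})}$, and set $y_j=P(G_v,L_{2,j},v_2,j,D-1)$.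 Return $\frac{(1-f_i)(1-y_i)}{\sum_{j\in L(v)}(1-f_j)(1-y_j)}$. (d) If $\deg_G(v)=3$ with neighbors $v_1,v_2,v_3$: for $j\in L(v)$ let $x_j=P(G_v,L_{1,j},v_1,j,D-1)$, $y_j=P(G_v,L_{2,j},v_2,j,D-1)$, $z_j=P(G_v,L_{3,j},v_3,j,D-1)$, and return $\frac{(1-x_i)(1-y_i)(1-z_i)}{\sum_{j\in L(v)}(1-x_j)(1-y_j)(1-z_j)}$. For reachable triples, all recursive calls are again on reachable triples and case (d) never occurs. -}

module Defs where

open import Data.Bool.Base using (Bool; false; T)
open import Data.Bool.Properties using (T?)
open import Data.Fin.Base using (Fin; toℕ; punchIn)
open import Data.Fin.Properties using (all?) renaming (_≟_ to _≟F_)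
open import Data.Fin.Subset using (Subset; _∈_; _∉_; ∁; ∣_∣) renaming (_-_ to _∖_)
open import Data.Fin.Subset.Properties using (_∈?_)
open import Data.Integer.Base using (ℤ; +_; -[1+_])
open import Data.List.Base using (List; []; _∷_; map; filter; length; allFin; take; lookup; foldr; cartesianProductWith)
open import Data.List.Relation.Binary.Permutation.Propositional using (_↭_; ↭-refl; swap)
open import Data.Nat.Base as ℕ using (ℕ; zero; suc)
import Data.Nat.Properties as ℕₚ
open import Data.Product.Base using (_×_; _,_)
open import Data.Rational.Base using (ℚ; 0ℚ; 1ℚ; _+_; _*_; _-_; _÷_; _/_; _≤_; ≢-nonZero)
open import Data.Rational.Properties using (_≟_)
open import Data.Vec.Base as Vec using (Vec)
open import Function.Base using (_∘_)
open import Relation.Binary.PropositionalEquality using (_≡_; _≢_; sym; trans)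
open import Relation.Nullary using (Dec; yes; no; ¬_; contradiction)
open import Relation.Nullary.Decidable using (_×-dec_; _→-dec_; ¬?)

import Data.List.Membership.DecPropositional as DecMembership

record Graph (n : ℕ) : Set where
  field
    adj        : Fin n → Fin n → Bool
    adj-sym    : ∀ u w → adj u w ≡ adj w u
    adj-irrefl : ∀ u → adj u u ≡ false

open Graph public

Color : Set
Color = Fin 4

Lists : ℕ → Set
Lists n = Fin n → Subset 4

deg : ∀ {n} → Graph n → Fin n → ℕ
deg {n} G v = length (filter (λ u → T? (adj G v u)) (allFin n))

-- G_v: the vertex u of `delete G v` is the vertex `punchIn v u` of G.
delete : ∀ {n} → Graph (suc n) → Fin (suc n) → Graph n
delete G v = record
  { adj        = λ u w → adj G (punchIn v u) (punchIn v w)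
  ; adj-sym    = λ u w → adj-sym G (punchIn v u) (punchIn v w)
  ; adj-irrefl = λ u → adj-irrefl G (punchIn v u)
  }

restrict : ∀ {n} → Lists (suc n) → Fin (suc n) → Lists n
restrict L v = L ∘ punchIn v

-- The neighbors of v in G, named as vertices of `delete G v`.
neighbors : ∀ {n} → Graph (suc n) → Fin (suc n) → List (Fin n)
neighbors {n} G v = filter (λ u → T? (adj G v (punchIn v u))) (allFin n)

-- With us = v₁ , … , v_{k-1} this is L_{k,j}.
strip : ∀ {n} → List (Fin n) → Color → Lists n → Lists n
strip us j L u with DecMembership._∈?_ _≟F_ u us
... | yes _ = L u ∖ j
... | no  _ = L u

Reachable : ∀ {n} → Graph n → Lists n → Fin n → Set
Reachable G L v =
  (∀ u → deg G u ℕ.≤ 3 × deg G u ℕ.+ 1 ℕ.≤ ∣ L u ∣) ×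
  deg G v ℕ.≤ 2 ×
  deg G v ℕ.+ 2 ℕ.≤ ∣ L v ∣

-- Division made total by p ÷₀ 0 = 0.  On reachable triples no denominator
-- below vanishes.
infixl 7 _÷₀_
_÷₀_ : ℚ → ℚ → ℚ
p ÷₀ q with q ≟ 0ℚ
... | yes _   = 0ℚ
... | no  q≢0 = _÷_ p q {{≢-nonZero q≢0}}

fromℕ : ℕ → ℚ
fromℕ n = + n / 1

elements : Subset 4 → List Color
elements S = filter (_∈? S) (allFin 4)

∑ : Subset 4 → (Color → ℚ) → ℚ
∑ S f = foldr _+_ 0ℚ (map f (elements S))

∏ : ∀ m → (Fin m → ℚ) → ℚ
∏ m f = foldr _*_ 1ℚ (map f (allFin m))

Proper : ∀ {n} → Graph n → Lists n → Vec Color n → Set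
Proper G L c =
  (∀ u → Vec.lookup c u ∈ L u) ×
  (∀ u w → T (adj G u w) → Vec.lookup c u ≢ Vec.lookup c w)

proper? : ∀ {n} (G : Graph n) (L : Lists n) (c : Vec Color n) → Dec (Proper G L c)
proper? G L c =
  all? (λ u → Vec.lookup c u ∈? L u) ×-dec
  all? (λ u → all? (λ w → T? (adj G u w) →-dec ¬? (Vec.lookup c u ≟F Vec.lookup c w)))

allColorings : ∀ n → List (Vec Color n)
allColorings zero    = Vec.[] ∷ []
allColorings (suc n) = cartesianProductWith Vec._∷_ (allFin 4) (allColorings n)

properColorings : ∀ {n} → Graph n → Lists n → List (Vec Color n)
properColorings {n} G L = filter (proper? G L) (allColorings n)

Pr : ∀ {n} → Graph n → Lists n → Fin n → Color → ℚ
Pr G L v i =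
  fromℕ (length (filter (λ c → Vec.lookup c v ≟F i) (properColorings G L)))
    ÷₀ fromℕ (length (properColorings G L))

-- The requirement on the order v₁ , v₂ of the neighbors of a vertex v of
-- degree 2; v₁ and v₂ are named as vertices of `delete G v`.
Admissible : ∀ {n} → Graph (suc n) → Lists (suc n) → Fin (suc n) → Color →
             Fin n → Fin n → Set
Admissible G L v i v₁ v₂ =
  deg G (punchIn v v₂) ℕ.≤ deg G (punchIn v v₁) ×
  (deg G (punchIn v v₁) ≡ 1 → deg G (punchIn v v₂) ≡ 1 →
   i ∉ L (punchIn v v₁) → i ∉ L (punchIn v v₂))

-- The choices the procedure leaves open.  `fixed` is the fixed order of each
-- neighborhood; `paired` is the order used at a vertex of degree 2, which
-- also depends on L and i.
record Ordering : Set where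
  field
    fixed    : ∀ {n} → Graph (suc n) → Fin (suc n) → List (Fin n)
    fixed-↭  : ∀ {n} (G : Graph (suc n)) v → fixed G v ↭ neighbors G v
    paired   : ∀ {n} → Graph (suc n) → Lists (suc n) → Fin (suc n) → Color →
               Fin n → Fin n → Fin n × Fin n
    paired-↭ : ∀ {n} (G : Graph (suc n)) L v i a b → fixed G v ≡ a ∷ b ∷ [] →
               let (v₁ , v₂) = paired G L v i a b in v₁ ∷ v₂ ∷ [] ↭ a ∷ b ∷ []
    paired-admissible :
               ∀ {n} (G : Graph (suc n)) L v i a b → fixed G v ≡ a ∷ b ∷ [] →
               let (v₁ , v₂) = paired G L v i a b in Admissible G L v i v₁ v₂

admissible? : ∀ {n} (G : Graph (suc n)) L v i (a b : Fin n) → Dec (Admissible G L v i a b)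
admissible? G L v i a b =
  (deg G (punchIn v b) ℕₚ.≤? deg G (punchIn v a)) ×-dec
  ((deg G (punchIn v a) ℕₚ.≟ 1) →-dec (deg G (punchIn v b) ℕₚ.≟ 1) →-dec
   ¬? (i ∈? L (punchIn v a)) →-dec ¬? (i ∈? L (punchIn v b)))

admissible-swap : ∀ {n} (G : Graph (suc n)) L v i (a b : Fin n) →
                  ¬ Admissible G L v i a b → Admissible G L v i b a
admissible-swap G L v i a b ¬ab with deg G (punchIn v b) ℕₚ.≤? deg G (punchIn v a)
... | no  b≰a = ℕₚ.<⇒≤ (ℕₚ.≰⇒> b≰a) ,
                λ b≡1 a≡1 → contradiction (ℕₚ.≤-reflexive (trans b≡1 (sym a≡1))) b≰a
... | yes b≤a with deg G (punchIn v a) ℕₚ.≤? deg G (punchIn v b)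
...   | yes a≤b = a≤b , λ _ _ i∉b _ → ¬ab (b≤a , λ _ _ _ → i∉b)
...   | no  a≰b = contradiction
                    (b≤a , λ a≡1 b≡1 → contradiction (ℕₚ.≤-reflexive (trans a≡1 (sym b≡1))) a≰b)
                    ¬ab

-- Admissible orders exist, so quantifying over `Ordering` is not vacuous.
defaultOrdering : Ordering
defaultOrdering = record
  { fixed             = neighbors
  ; fixed-↭           = λ _ _ → ↭-refl
  ; paired            = pair
  ; paired-↭          = λ G L v i a b _ → pair-↭ G L v i a b
  ; paired-admissible = λ G L v i a b _ → pair-admissible G L v i a b
  }
  where
  pair : ∀ {n} → Graph (suc n) → Lists (suc n) → Fin (suc n) → Color →
         Fin n → Fin n → Fin n × Fin n
  pair G L v i a b with admissible? G L v i a b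
  ... | yes _ = a , b
  ... | no  _ = b , a

  pair-↭ : ∀ {n} (G : Graph (suc n)) L v i a b →
           let (v₁ , v₂) = pair G L v i a b in v₁ ∷ v₂ ∷ [] ↭ a ∷ b ∷ []
  pair-↭ G L v i a b with admissible? G L v i a b
  ... | yes _ = ↭-refl
  ... | no  _ = swap b a ↭-refl

  pair-admissible : ∀ {n} (G : Graph (suc n)) L v i a b →
                    let (v₁ , v₂) = pair G L v i a b in Admissible G L v i v₁ v₂
  pair-admissible G L v i a b with admissible? G L v i a b
  ... | yes ab = ab
  ... | no ¬ab = admissible-swap G L v i a b ¬ab

-- A value for every (G , L , v , i); instantiated with P at depth D - 1.
Estimate : Set
Estimate = ∀ {n} → Graph n → Lists n → Fin n → Color → ℚ

-- Degree 1, with S = L(v) ∋ i and q j = P(G_v , L , v₁ , j , D - 1).  The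
-- last clause is reached only if ∣ S ∣ = 1, where the procedure is undefined.
degree1 : (Color → ℚ) → Subset 4 → Color → ℚ
degree1 q S i with ∣ S ∣ | elements (S ∖ i) | elements (∁ S)
... | 2 | j ∷ [] | _      = (1ℚ - q i) ÷₀ (fromℕ 2 - q i - q j)
... | 4 | _      | _      = (1ℚ - q i) ÷₀ fromℕ 3
... | 3 | _      | j ∷ [] = (1ℚ - q i) ÷₀ (fromℕ 2 + q j)
... | _ | _      | _      = 0ℚ

module _ (ω : Ordering) where
  open Ordering ω

  -- ∏ₖ (1 - x_{k,w}), computed in the graph H = G_v at its vertex v₁.
  survival : Estimate → ∀ {n} → Graph n → Lists n → Fin n → Color → ℚ
  survival p {suc n} H L v₁ w =
    ∏ (length us) λ k →
      1ℚ - p (delete H v₁) (strip (take (toℕ k) us) w (restrict L v₁)) (lookup us k) w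
    where
    us : List (Fin n)
    us = fixed H v₁

  degree2 : Estimate → ∀ {n} → Graph (suc n) → Lists (suc n) → Fin (suc n) → Color →
            Fin n → Fin n → ℚ
  degree2 p G L v i v₁ v₂ =
    ((1ℚ - f i) * (1ℚ - y i)) ÷₀ ∑ (L v) (λ j → (1ℚ - f j) * (1ℚ - y j))
    where
    H  = delete G v
    Lᵥ = restrict L v
    f : Color → ℚ
    f j with j ∈? Lᵥ v₁
    ... | no  _ = 0ℚ
    ... | yes _ = survival p H Lᵥ v₁ j ÷₀ ∑ (Lᵥ v₁) (survival p H Lᵥ v₁)
    y : Color → ℚ
    y j = p H (strip (v₁ ∷ []) j Lᵥ) v₂ j

  degree3 : Estimate → ∀ {n} → Graph (suc n) → Lists (suc n) → Fin (suc n) → Color →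
            Fin n → Fin n → Fin n → ℚ
  degree3 p G L v i v₁ v₂ v₃ = g i ÷₀ ∑ (L v) g
    where
    H  = delete G v
    Lᵥ = restrict L v
    g : Color → ℚ
    g j = (1ℚ - p H Lᵥ v₁ j)
        * (1ℚ - p H (strip (v₁ ∷ []) j Lᵥ) v₂ j)
        * (1ℚ - p H (strip (v₁ ∷ v₂ ∷ []) j Lᵥ) v₃ j)

  -- The recursive step for i ∈ L(v) and D > 0.  The procedure is undefined
  -- in degree greater than 3.
  step : Estimate → ∀ {n} → Graph n → Lists n → Fin n → Color → ℚ
  step p {suc n} G L v i with fixed G v
  ... | []                = 1ℚ ÷₀ fromℕ ∣ L v ∣
  ... | v₁ ∷ []           = degree1 (p (delete G v) (restrict L v) v₁) (L v) i
  ... | a ∷ b ∷ []        = let (v₁ , v₂) = paired G L v i a b in degree2 p G L v i v₁ v₂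
  ... | v₁ ∷ v₂ ∷ v₃ ∷ [] = degree3 p G L v i v₁ v₂ v₃
  ... | _ ∷ _ ∷ _ ∷ _ ∷ _ = 0ℚ

  P : ∀ {n} → Graph n → Lists n → Fin n → Color → ℤ → ℚ
  P G L v i D with i ∈? L v
  P G L v i D           | no  _ = 0ℚ
  P G L v i -[1+ _ ]    | yes _ = 1ℚ ÷₀ fromℕ ∣ L v ∣
  P G L v i (+ zero)    | yes _ = 1ℚ ÷₀ fromℕ ∣ L v ∣
  P G L v i (+ (suc D)) | yes _ = step (λ G′ L′ v′ i′ → P G′ L′ v′ i′ (+ D)) G L v i

InInterval : ℚ → Set
InInterval p = + 1 / 13 ≤ p × p ≤ + 13 / 27

{-# OPTIONS --safe #-}
-- With enough depth the procedure computes Pr exactly: deleting v and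
-- telescoping over its neighbors gives the recursion for the number of proper
-- colorings, and the depth needed is at most the number of vertices.  So it
-- suffices that the class (0, ½, or in [1/13 , 13/27]) of the computed value
-- is the same for all depths D ≥ 2.  At every depth a value for a listed
-- color lies in [1/13 , ½].  In degree 2 the value is N / (N + R) with
-- N = (1 - f_i)(1 - y_i) and R = 1 + f_i / 2 + ∑_{j ≠ i} (1 - f_j)(½ - y_j),
-- because ∑ f_j = 1.  If i is listed at v₁ or v₂ then N ≤ 12/13.  Otherwise
-- N = 1, and either v, v₁, v₂ form a triangle and R = 1, or R ≥ 14/13.
module Submission where

open import Defs
open import Data.Bool.Base using (Bool; true; false; T)
open import Data.Bool.Properties using (T?)
open import Data.Fin.Base using (Fin; zero; suc; toℕ; punchIn; punchOut)
open import Data.Fin.Patterns using (0F; 1F; 2F; 3F)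
open import Data.Fin.Properties using (punchIn-punchOut; punchInᵢ≢i) renaming (_≟_ to _≟F_)
open import Data.Fin.Subset using (Subset; _∈_; _∉_; ∁; ∣_∣; ⊤; ⊥; ⁅_⁆; inside; outside; Nonempty) renaming (_-_ to _∖_)
open import Data.Fin.Subset.Properties using (_∈?_; ∈⊤; ∣p∣≤n; ∣p∣≡n⇒p≡⊤; x∉p⇒x∈∁p; x≢y⇒x∉⁅y⁆; x∈p∧x≢y⇒x∈p-y; p─q⊆p; p─⊥≡p)
open import Data.Integer.Base as ℤ using (ℤ; +_; +≤+; _≤_)
import Data.Integer.Properties as ℤₚ
open import Data.List.Base using (List; []; _∷_; _++_; map; filter; length; allFin; take; lookup; foldr; tabulate; cartesianProductWith)
import Data.List.Membership.DecPropositional as DecMembership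
open import Data.List.Membership.Propositional using () renaming (_∈_ to _∈ᴸ_; _∉_ to _∉ᴸ_)
open import Data.List.Membership.Propositional.Properties using (∈-++⁺ˡ; ∈-++⁺ʳ; ∈-++⁻; ∈-filter⁺; ∈-filter⁻; ∈-allFin)
open import Data.List.Properties using (filter-++; filter-≐; filter-none; length-filter; length-++; map-cong; map-tabulate; ++-assoc; ++-identityʳ)
open import Data.List.Relation.Binary.Permutation.Propositional using (_↭_; ↭-sym; ↭-trans; ↭-refl; ↭⇒↭ₛ)
open import Data.List.Relation.Binary.Permutation.Propositional.Properties using (∈-resp-↭; ↭-length)
open import Data.List.Relation.Binary.Permutation.Setoid.Properties using (Unique-resp-↭)
import Data.List.Relation.Unary.All as All
open import Data.List.Relation.Unary.AllPairs using (_∷_)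
import Data.List.Relation.Unary.Unique.Propositional.Properties as Uniqueₚ
open import Data.List.Relation.Unary.Any using (here; there)
open import Data.Nat.Base as ℕ using (ℕ; zero; suc; z≤n; s≤s)
import Data.Nat.Properties as ℕₚ
import Data.Nat.Coprimality as Coprime
open import Data.Nat.ListAction using (sum)
import Data.Nat.Solver
open import Data.Product.Base using (Σ; ∃; _×_; _,_; proj₁; proj₂)
open import Data.Rational.Base as ℚ using (ℚ; 0ℚ; 1ℚ; ½; _+_; _*_; _-_; _/_)
import Data.Rational.Properties as ℚₚ
open import Data.Rational.Solver using (module +-*-Solver)
open import Data.Sum.Base using (_⊎_; inj₁; inj₂)
open import Data.Vec.Base as Vec using (Vec; insertAt; here; there)
open import Data.Vec.Properties using (insertAt-lookup; insertAt-punchIn; []=⇒lookup; lookup⇒[]=)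
open import Function.Base using (_∘_)
open import Function.Bundles using (_⇔_; mk⇔)
open import Relation.Binary.PropositionalEquality using (_≡_; _≢_; refl; setoid; sym; trans; cong; cong₂; subst; module ≡-Reasoning)
open import Relation.Nullary using (Dec; yes; no; ¬_; contradiction)
open import Relation.Nullary.Decidable using (_×-dec_; ¬?; True; toWitness; toWitnessFalse)
open import Relation.Unary using (Decidable)
open +-*-Solver using (solve; _:=_; _:+_; _:*_; _:-_; con)
open Data.Nat.Solver.+-*-Solver using () renaming (solve to solveᴺ; _:=_ to _:=ᴺ_; _:+_ to _:+ᴺ_)

-- The class of a value is settled by `G`, `L`, `v` and `i` before any depth is chosen, so a shallow
-- value and the exact one can be compared although they may differ numerically. Depth 2 is the
-- least that sees the triangle, because the estimate at `v₂` must itself consult its remaining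
-- neighbor: at depth 1 the three values `y_j` with `j ≠ i` would be 1/3, and the result 3/7 instead
-- of ½. The constants feed one another. Values at most ½ keep every factor 1 - x at least ½; since
-- `v₁` has at most two further neighbors, its weights are at least ¼ and a normalized weight is at
-- most 4/7. The bounds then let the ratio fall to (3/14) / (39/14) = 1/13, which is also the least
-- normalized weight, ¼ against 3. In turn 1/13 separates values from ½: 13/27 = 1 / (2 + 1/13).

private
  variable
    n : ℕ

-- Counting by filters on lists and on colorings

filter-filter : ∀ {A : Set} {P Q : A → Set} (P? : Decidable P) (Q? : Decidable Q) xs →
                filter Q? (filter P? xs) ≡ filter (λ x → P? x ×-dec Q? x) xs
filter-filter P? Q? [] = refl
filter-filter P? Q? (x ∷ xs) with P? x
... | no  _ = filter-filter P? Q? xs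
... | yes _ with Q? x
...   | no  _ = filter-filter P? Q? xs
...   | yes _ = cong (x ∷_) (filter-filter P? Q? xs)

length-filter-map : ∀ {A B : Set} {P : B → Set} (P? : Decidable P) (f : A → B) xs →
                    length (filter P? (map f xs)) ≡ length (filter (P? ∘ f) xs)
length-filter-map P? f [] = refl
length-filter-map P? f (x ∷ xs) with P? (f x)
... | no  _ = length-filter-map P? f xs
... | yes _ = cong suc (length-filter-map P? f xs)

length-filter-split : ∀ {A : Set} {P : A → Set} (P? : Decidable P) xs →
                      length (filter (¬? ∘ P?) xs) ℕ.+ length (filter P? xs) ≡ length xs
length-filter-split P? [] = refl
length-filter-split P? (x ∷ xs) with P? x
... | no  _ = cong suc (length-filter-split P? xs)
... | yes _ = trans (ℕₚ.+-suc _ _) (cong suc (length-filter-split P? xs))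

length-filter-product :
  ∀ {A B C : Set} {P : C → Set} (P? : Decidable P) (f : A → B → C) xs ys →
  length (filter P? (cartesianProductWith f xs ys)) ≡
  sum (map (λ x → length (filter (P? ∘ f x) ys)) xs)
length-filter-product P? f [] ys = refl
length-filter-product P? f (x ∷ xs) ys =
  trans (cong length (filter-++ P? (map (f x) ys) _))
    (trans (length-++ (filter P? (map (f x) ys)))
      (cong₂ ℕ._+_ (length-filter-map P? (f x) ys) (length-filter-product P? f xs ys)))

countColorings : {P : Vec Color n → Set} → Decidable P → ℕ
countColorings P? = length (filter P? (allColorings _))

countColorings-cong : ∀ {P Q : Vec Color n → Set} (P? : Decidable P) (Q? : Decidable Q) →
                      (∀ c → P c → Q c) → (∀ c → Q c → P c) →
                      countColorings P? ≡ countColorings Q?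
countColorings-cong P? Q? to from = cong length (filter-≐ P? Q? ((λ {c} → to c) , (λ {c} → from c)) (allColorings _))

countColorings-none : ∀ {P : Vec Color n → Set} (P? : Decidable P) →
                      (∀ c → ¬ P c) → countColorings P? ≡ 0
countColorings-none P? ¬P = cong length (filter-none P? (All.universal ¬P (allColorings _)))

countColorings-sum : ∀ {P : Vec Color (suc n) → Set} (P? : Decidable P) →
  countColorings P? ≡ sum (map (λ a → countColorings (λ d → P? (a Vec.∷ d))) (allFin 4))
countColorings-sum P? = length-filter-product P? Vec._∷_ (allFin 4) (allColorings _)

sum-single : ∀ (f : Color → ℕ) j → (∀ a → a ≢ j → f a ≡ 0) → sum (map f (allFin 4)) ≡ f j
sum-single f 0F z rewrite z 1F (λ ()) | z 2F (λ ()) | z 3F (λ ()) = ℕₚ.+-identityʳ _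
sum-single f 1F z rewrite z 0F (λ ()) | z 2F (λ ()) | z 3F (λ ()) = ℕₚ.+-identityʳ _
sum-single f 2F z rewrite z 0F (λ ()) | z 1F (λ ()) | z 3F (λ ()) = ℕₚ.+-identityʳ _
sum-single f 3F z rewrite z 0F (λ ()) | z 1F (λ ()) | z 2F (λ ()) = ℕₚ.+-identityʳ _

sum-cong : ∀ {f g : Color → ℕ} → (∀ a → f a ≡ g a) → sum (map f (allFin 4)) ≡ sum (map g (allFin 4))
sum-cong e rewrite e 0F | e 1F | e 2F | e 3F = refl

-- Leading coordinates are peeled off until `v` is the head of the vector; there only the summand of
-- the color `j` survives.
countColorings-insertAt :
  ∀ {P : Vec Color (suc n) → Set} (P? : Decidable P) (v : Fin (suc n)) j →
  countColorings (λ c → P? c ×-dec (Vec.lookup c v ≟F j)) ≡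
  countColorings (λ d → P? (insertAt d v j))
countColorings-insertAt P? zero j =
  trans (countColorings-sum (λ c → P? c ×-dec (Vec.lookup c zero ≟F j)))
    (trans (sum-single (λ a → countColorings (at a)) j
             λ a a≢j → countColorings-none (at a) λ _ p → a≢j (proj₂ p))
      (countColorings-cong (at j) (λ d → P? (j Vec.∷ d)) (λ _ → proj₁) (λ _ p → p , refl)))
  where
  at : ∀ a → Decidable _
  at a d = P? (a Vec.∷ d) ×-dec (a ≟F j)
countColorings-insertAt {suc n} P? (suc v) j =
  trans (countColorings-sum (λ c → P? c ×-dec (Vec.lookup c (suc v) ≟F j)))
    (trans (sum-cong λ a → countColorings-insertAt (λ d → P? (a Vec.∷ d)) v j)
      (sym (countColorings-sum (λ d → P? (insertAt d (suc v) j)))))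

-- Stripped lists and vertex deletion

module _ {n : ℕ} (L : Lists n) (us : List (Fin n)) (j : Color) where

  strip-∈ : ∀ u → u ∈ᴸ us → strip us j L u ≡ L u ∖ j
  strip-∈ u u∈us with DecMembership._∈?_ _≟F_ u us
  ... | yes _    = refl
  ... | no  u∉us = contradiction u∈us u∉us

  strip-∉ : ∀ u → u ∉ᴸ us → strip us j L u ≡ L u
  strip-∉ u u∉us with DecMembership._∈?_ _≟F_ u us
  ... | yes u∈us = contradiction u∈us u∉us
  ... | no  _    = refl

x∉p∖x : ∀ {m} (p : Subset m) x → x ∉ p ∖ x
x∉p∖x (b Vec.∷ p) zero    ()
x∉p∖x (b Vec.∷ p) (suc x) (there x∈) = x∉p∖x p x x∈

module _ {n : ℕ} (L : Lists n) (us : List (Fin n)) (j : Color) where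

  ∈-strip⁺ : ∀ {k} u → k ∈ L u → (u ∈ᴸ us → k ≢ j) → k ∈ strip us j L u
  ∈-strip⁺ u k∈L k≢j with DecMembership._∈?_ _≟F_ u us
  ... | yes u∈us = x∈p∧x≢y⇒x∈p-y k∈L (k≢j u∈us)
  ... | no  _    = k∈L

  ∈-strip⁻ : ∀ {k} u → k ∈ strip us j L u → k ∈ L u × (u ∈ᴸ us → k ≢ j)
  ∈-strip⁻ u k∈S with DecMembership._∈?_ _≟F_ u us
  ... | yes u∈us = p─q⊆p (L u) _ k∈S , λ _ k≡j → x∉p∖x (L u) j (subst (_∈ L u ∖ j) k≡j k∈S)
  ... | no  u∉us = k∈S , λ u∈us → contradiction u∈us u∉us

-- Matching on this view brings a vertex of `G` into the form `punchIn v u`, the only form in which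
-- the adjacency and lists of `delete G v` speak about `G`.
data PunchView {n} (v : Fin (suc n)) : Fin (suc n) → Set where
  same  : PunchView v v
  other : ∀ u → PunchView v (punchIn v u)

punchView : ∀ (v x : Fin (suc n)) → PunchView v x
punchView v x with v ≟F x
... | yes refl = same
... | no  v≢x  = subst (PunchView v) (punchIn-punchOut v≢x) (other (punchOut v≢x))

-- us lists, in some order and as vertices of `delete G v`, the neighbors of v.
Enumerates : Graph (suc n) → Fin (suc n) → List (Fin n) → Set
Enumerates G v us = us ↭ neighbors G v

module _ (G : Graph (suc n)) (v : Fin (suc n)) {us : List (Fin n)} (e : Enumerates G v us) where

  enumerates⁻ : ∀ {u} → u ∈ᴸ us → T (adj G v (punchIn v u))
  enumerates⁻ u∈us = proj₂ (∈-filter⁻ (λ u → T? (adj G v (punchIn v u))) {xs = allFin _} (∈-resp-↭ e u∈us))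

  enumerates⁺ : ∀ {u} → T (adj G v (punchIn v u)) → u ∈ᴸ us
  enumerates⁺ a = ∈-resp-↭ (↭-sym e) (∈-filter⁺ (λ u → T? (adj G v (punchIn v u))) (∈-allFin _) a)

-- Proper colorings counted by the color of one vertex

numProper : Graph n → Lists n → ℕ
numProper G L = length (properColorings G L)

numProperAt : Graph n → Lists n → Fin n → Color → ℕ
numProperAt G L v j = length (filter (λ c → Vec.lookup c v ≟F j) (properColorings G L))

numProperAt≡ : ∀ (G : Graph n) L v j →
  numProperAt G L v j ≡ countColorings (λ c → proper? G L c ×-dec (Vec.lookup c v ≟F j))
numProperAt≡ G L v j = cong length (filter-filter (proper? G L) _ (allColorings _))

T-adj-irrefl : ∀ (G : Graph n) u → ¬ T (adj G u u)
T-adj-irrefl G u a = subst T (adj-irrefl G u) a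

T-adj-sym : ∀ (G : Graph n) u w → T (adj G u w) → T (adj G w u)
T-adj-sym G u w = subst T (adj-sym G u w)

module _ (G : Graph (suc n)) (L : Lists (suc n)) (v : Fin (suc n)) (j : Color)
         {us : List (Fin n)} (e : Enumerates G v us) where

  proper-insertAt⁻ : ∀ d → Proper G L (insertAt d v j) →
                     Proper (delete G v) (strip us j (restrict L v)) d
  proper-insertAt⁻ d (inL , edge) =
    (λ u → ∈-strip⁺ (restrict L v) us j u (subst (_∈ L (punchIn v u)) (insertAt-punchIn d v j u) (inL (punchIn v u)))
             λ u∈us du≡j → edge v (punchIn v u) (enumerates⁻ G v e u∈us)
               (trans (insertAt-lookup d v j) (sym (trans (insertAt-punchIn d v j u) du≡j)))) ,
    λ u w a du≡dw → edge (punchIn v u) (punchIn v w) a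
      (trans (insertAt-punchIn d v j u) (trans du≡dw (sym (insertAt-punchIn d v j w))))

  proper-insertAt⁺ : j ∈ L v → ∀ d → Proper (delete G v) (strip us j (restrict L v)) d →
                     Proper G L (insertAt d v j)
  proper-insertAt⁺ j∈L d (inS , edge) = inL , edge′
    where
    inL : ∀ x → Vec.lookup (insertAt d v j) x ∈ L x
    inL x with punchView v x
    ... | same    = subst (_∈ L v) (sym (insertAt-lookup d v j)) j∈L
    ... | other u = subst (_∈ L (punchIn v u)) (sym (insertAt-punchIn d v j u))
                      (proj₁ (∈-strip⁻ (restrict L v) us j u (inS u)))

    clash : ∀ u → T (adj G v (punchIn v u)) →
            Vec.lookup (insertAt d v j) v ≢ Vec.lookup (insertAt d v j) (punchIn v u)
    clash u a eq = proj₂ (∈-strip⁻ (restrict L v) us j u (inS u)) (enumerates⁺ G v e a)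
      (trans (sym (insertAt-punchIn d v j u)) (trans (sym eq) (insertAt-lookup d v j)))

    edge′ : ∀ x y → T (adj G x y) → Vec.lookup (insertAt d v j) x ≢ Vec.lookup (insertAt d v j) y
    edge′ x y a with punchView v x | punchView v y
    ... | same    | same    = contradiction a (T-adj-irrefl G v)
    ... | same    | other w = clash w a
    ... | other u | same    = λ eq → clash u (T-adj-sym G _ _ a) (sym eq)
    ... | other u | other w = λ eq → edge u w a
          (trans (sym (insertAt-punchIn d v j u)) (trans eq (insertAt-punchIn d v j w)))

  -- Giving `v` the color `j` constrains the other vertices only by forbidding `j` at the neighbors,
  -- which is what stripping along all of `us` does.
  numProperAt-delete : j ∈ L v →
    numProperAt G L v j ≡ numProper (delete G v) (strip us j (restrict L v))
  numProperAt-delete j∈L =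
    trans (numProperAt≡ G L v j)
      (trans (countColorings-insertAt (proper? G L) v j)
        (countColorings-cong (λ d → proper? G L (insertAt d v j))
          (proper? (delete G v) (strip us j (restrict L v))) proper-insertAt⁻ (proper-insertAt⁺ j∈L)))

numProperAt-∉ : ∀ (G : Graph n) L v {j} → j ∉ L v → numProperAt G L v j ≡ 0
numProperAt-∉ G L v {j} j∉L = trans (numProperAt≡ G L v j)
  (countColorings-none (λ c → proper? G L c ×-dec (Vec.lookup c v ≟F j))
    λ c p → j∉L (subst (_∈ L v) (proj₂ p) (proj₁ (proj₁ p) v)))

-- A coloring for the lists stripped along `us` either uses `j` at `u` or survives stripping `u` as
-- well. This is one step of the telescoping.
numProper-strip : ∀ (G : Graph n) L us u j →
  numProper G (strip (us ++ u ∷ []) j L) ℕ.+ numProperAt G (strip us j L) u j ≡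
  numProper G (strip us j L)
numProper-strip G L us u j =
  trans (cong (ℕ._+ numProperAt G (strip us j L) u j) step₁)
    (length-filter-split (λ c → Vec.lookup c u ≟F j) (properColorings G (strip us j L)))
  where
  us⁺ = us ++ u ∷ []

  to : ∀ c → Proper G (strip (us ++ u ∷ []) j L) c →
       Proper G (strip us j L) c × Vec.lookup c u ≢ j
  to c (inS , edge) =
    ((λ x → let p = ∈-strip⁻ L us⁺ j x (inS x) in ∈-strip⁺ L us j x (proj₁ p) (proj₂ p ∘ ∈-++⁺ˡ)) , edge) ,
    proj₂ (∈-strip⁻ L us⁺ j u (inS u)) (∈-++⁺ʳ us (here refl))

  from : ∀ c → Proper G (strip us j L) c × Vec.lookup c u ≢ j →
         Proper G (strip (us ++ u ∷ []) j L) c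
  from c ((inS , edge) , cu≢j) =
    (λ x → let p = ∈-strip⁻ L us j x (inS x) in ∈-strip⁺ L us⁺ j x (proj₁ p) λ x∈ → avoid x p (∈-++⁻ us x∈)) , edge
    where
    avoid : ∀ x → Vec.lookup c x ∈ L x × (x ∈ᴸ us → Vec.lookup c x ≢ j) →
            x ∈ᴸ us ⊎ x ∈ᴸ u ∷ [] → Vec.lookup c x ≢ j
    avoid x p (inj₁ x∈us)        = proj₂ p x∈us
    avoid x p (inj₂ (here refl)) = cu≢j

  step₁ : numProper G (strip (us ++ u ∷ []) j L) ≡
          length (filter (λ c → ¬? (Vec.lookup c u ≟F j)) (properColorings G (strip us j L)))
  step₁ = trans (countColorings-cong (proper? G (strip us⁺ j L))
            (λ c → proper? G (strip us j L) c ×-dec ¬? (Vec.lookup c u ≟F j)) to from)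
    (sym (cong length (filter-filter (proper? G (strip us j L)) (λ c → ¬? (Vec.lookup c u ≟F j)) (allColorings _))))

numProper-sum : ∀ (G : Graph n) L v → numProper G L ≡ sum (map (numProperAt G L v) (allFin 4))
numProper-sum G L v = go (properColorings G L)
  where
  shift : ∀ x y z → suc (x ℕ.+ (y ℕ.+ z)) ≡ x ℕ.+ (y ℕ.+ suc z)
  shift x y z = trans (sym (ℕₚ.+-suc x (y ℕ.+ z))) (cong (x ℕ.+_) (sym (ℕₚ.+-suc y z)))

  at : List (Vec Color _) → Color → ℕ
  at cs a = length (filter (λ c → Vec.lookup c v ≟F a) cs)

  go : ∀ cs → length cs ≡ sum (map (at cs) (allFin 4))
  go [] = refl
  go (c ∷ cs) with Vec.lookup c v
  ... | 0F = cong suc (go cs)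
  ... | 1F = trans (cong suc (go cs)) (sym (ℕₚ.+-suc (at cs 0F) _))
  ... | 2F = trans (cong suc (go cs)) (shift (at cs 0F) (at cs 1F) _)
  ... | 3F = trans (cong suc (go cs)) (trans (shift (at cs 0F) (at cs 1F) (at cs 2F ℕ.+ (at cs 3F ℕ.+ 0)))
               (cong (λ t → at cs 0F ℕ.+ (at cs 1F ℕ.+ t)) (sym (ℕₚ.+-suc (at cs 2F) _))))

-- Degrees after deleting a vertex

bit : Bool → ℕ
bit true  = 1
bit false = 0

countTrue : (Fin n → Bool) → ℕ
countTrue f = length (filter (λ u → T? (f u)) (allFin _))

countTrue-suc : ∀ (f : Fin (suc n) → Bool) → countTrue f ≡ bit (f zero) ℕ.+ countTrue (f ∘ suc)
countTrue-suc {n} f = trans (head (f zero) refl) (cong (bit (f zero) ℕ.+_) tail)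
  where
  head : ∀ b → f zero ≡ b →
         countTrue f ≡ bit b ℕ.+ length (filter (λ u → T? (f u)) (tabulate suc))
  head true  eq rewrite eq = refl
  head false eq rewrite eq = refl

  tail : length (filter (λ u → T? (f u)) (tabulate suc)) ≡ countTrue (f ∘ suc)
  tail = trans (cong (λ us → length (filter (λ u → T? (f u)) us)) (sym (map-tabulate {n = n} (λ u → u) suc)))
           (length-filter-map (λ u → T? (f u)) suc (allFin n))

-- `deg` counts over all vertices of `G`, `neighbors` and degrees in `delete G v` over the others.
-- Splitting off the position `v` is what compares them.
countTrue-punchIn : ∀ (f : Fin (suc n) → Bool) v →
                    countTrue f ≡ bit (f v) ℕ.+ countTrue (f ∘ punchIn v)
countTrue-punchIn         f zero    = countTrue-suc f
countTrue-punchIn {suc n} f (suc v) = begin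
  countTrue f                                             ≡⟨ countTrue-suc f ⟩
  b₀ ℕ.+ countTrue (f ∘ suc)                              ≡⟨ cong (b₀ ℕ.+_) (countTrue-punchIn (f ∘ suc) v) ⟩
  b₀ ℕ.+ (bᵥ ℕ.+ countTrue (f ∘ suc ∘ punchIn v))         ≡⟨ swap b₀ bᵥ _ ⟩
  bᵥ ℕ.+ (b₀ ℕ.+ countTrue (f ∘ suc ∘ punchIn v))         ≡⟨ cong (bᵥ ℕ.+_) (countTrue-suc (f ∘ punchIn (suc v))) ⟨
  bᵥ ℕ.+ countTrue (f ∘ punchIn (suc v))                  ∎
  where
  open ≡-Reasoning
  b₀ = bit (f zero)
  bᵥ = bit (f (suc v))
  swap : ∀ x y z → x ℕ.+ (y ℕ.+ z) ≡ y ℕ.+ (x ℕ.+ z)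
  swap x y z = trans (sym (ℕₚ.+-assoc x y z)) (trans (cong (ℕ._+ z) (ℕₚ.+-comm x y)) (ℕₚ.+-assoc y x z))

length-enumerates : ∀ (G : Graph (suc n)) v {us} → Enumerates G v us → length us ≡ deg G v
length-enumerates G v e = trans (↭-length e)
  (sym (trans (countTrue-punchIn (adj G v) v) (cong (λ b → bit b ℕ.+ countTrue (adj G v ∘ punchIn v)) (adj-irrefl G v))))

deg-neighbor : ∀ (G : Graph (suc n)) v u → T (adj G v (punchIn v u)) →
               deg G (punchIn v u) ≡ suc (deg (delete G v) u)
deg-neighbor G v u a = trans (countTrue-punchIn (adj G (punchIn v u)) v)
  (cong (ℕ._+ deg (delete G v) u) (bit-T (adj G (punchIn v u) v) (T-adj-sym G _ _ a)))
  where
  bit-T : ∀ b → T b → bit b ≡ 1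
  bit-T true _ = refl

deg-delete-≤ : ∀ (G : Graph (suc n)) v u → deg (delete G v) u ℕ.≤ deg G (punchIn v u)
deg-delete-≤ G v u = ℕₚ.≤-trans (ℕₚ.m≤n+m _ (bit (adj G (punchIn v u) v)))
  (ℕₚ.≤-reflexive (sym (countTrue-punchIn (adj G (punchIn v u)) v)))

∣p∣≤1+∣p∖x∣ : ∀ {m} (p : Subset m) x → ∣ p ∣ ℕ.≤ suc ∣ p ∖ x ∣
∣p∣≤1+∣p∖x∣ (inside  Vec.∷ p) zero    = s≤s (ℕₚ.≤-reflexive (cong ∣_∣ (sym (p─⊥≡p p))))
∣p∣≤1+∣p∖x∣ (outside Vec.∷ p) zero    = ℕₚ.m≤n⇒m≤1+n (ℕₚ.≤-reflexive (cong ∣_∣ (sym (p─⊥≡p p))))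
∣p∣≤1+∣p∖x∣ (inside  Vec.∷ p) (suc x) = s≤s (∣p∣≤1+∣p∖x∣ p x)
∣p∣≤1+∣p∖x∣ (outside Vec.∷ p) (suc x) = ∣p∣≤1+∣p∖x∣ p x

0<∣p∣⇒nonempty : ∀ {m} (p : Subset m) → 0 ℕ.< ∣ p ∣ → Nonempty p
0<∣p∣⇒nonempty (inside  Vec.∷ p) _   = zero , here
0<∣p∣⇒nonempty (outside Vec.∷ p) 0<p = let (x , x∈p) = 0<∣p∣⇒nonempty p 0<p in suc x , there x∈p

-- Valid and reachable instances under deletion

Valid : Graph n → Lists n → Set
Valid G L = ∀ u → deg G u ℕ.≤ 3 × deg G u ℕ.+ 1 ℕ.≤ ∣ L u ∣

module _ (G : Graph (suc n)) (L : Lists (suc n)) (v : Fin (suc n)) (valid : Valid G L) (j : Color)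
         (pre : List (Fin n)) (adjacent : ∀ {u} → u ∈ᴸ pre → T (adj G v (punchIn v u))) where

  -- A vertex of `pre` may lose the color `j`, but it also loses its edge to `v`, so its list still
  -- exceeds its degree.
  valid-strip : Valid (delete G v) (strip pre j (restrict L v))
  valid-strip u = ℕₚ.≤-trans (deg-delete-≤ G v u) (proj₁ (valid (punchIn v u))) , size
    where
    size : deg (delete G v) u ℕ.+ 1 ℕ.≤ ∣ strip pre j (restrict L v) u ∣
    size with DecMembership._∈?_ _≟F_ u pre
    ... | no  _     = ℕₚ.≤-trans (ℕₚ.+-monoˡ-≤ 1 (deg-delete-≤ G v u)) (proj₂ (valid (punchIn v u)))
    ... | yes u∈pre = ℕₚ.≤-pred (ℕₚ.≤-trans
          (ℕₚ.≤-trans (ℕₚ.≤-reflexive (cong (ℕ._+ 1) (sym (deg-neighbor G v u (adjacent u∈pre)))))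
            (proj₂ (valid (punchIn v u))))
          (∣p∣≤1+∣p∖x∣ (L (punchIn v u)) j))

  -- Outside `pre` the neighbor `u` loses its edge to `v` but no color: its surplus of colors over
  -- degree rises from 1 to 2, and its degree drops to at most 2.
  reachable-strip : ∀ u → T (adj G v (punchIn v u)) → u ∉ᴸ pre →
                    Reachable (delete G v) (strip pre j (restrict L v)) u
  reachable-strip u a u∉pre = valid-strip ,
    ℕₚ.≤-pred (subst (ℕ._≤ 3) d≡ (proj₁ (valid (punchIn v u)))) ,
    subst (λ S → deg (delete G v) u ℕ.+ 2 ℕ.≤ ∣ S ∣) (sym (strip-∉ (restrict L v) pre j u u∉pre))
      (subst (ℕ._≤ ∣ L (punchIn v u) ∣) (trans (cong (ℕ._+ 1) d≡) (sym (ℕₚ.+-suc _ 1)))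
        (proj₂ (valid (punchIn v u))))
    where
    d≡ = deg-neighbor G v u a

-- Greedy coloring: any listed color can be given to the first vertex, since deleting that vertex
-- and stripping its neighbors keeps the instance valid.
numProper>0 : ∀ (G : Graph n) L → Valid G L → 0 ℕ.< numProper G L
numProper>0 {zero} G L _ with proper? G L Vec.[]
... | yes _ = s≤s z≤n
... | no ¬p = contradiction ((λ ()) , (λ ())) ¬p
numProper>0 {suc n} G L valid = ℕₚ.≤-trans
  (subst (0 ℕ.<_) (sym (numProperAt-delete G L zero j {neighbors G zero} ↭-refl j∈L))
    (numProper>0 (delete G zero) _
      (valid-strip G L zero valid j (neighbors G zero) (enumerates⁻ G zero ↭-refl))))
  (length-filter (λ c → Vec.lookup c zero ≟F j) (properColorings G L))
  where
  nonempty : Nonempty (L zero)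
  nonempty = 0<∣p∣⇒nonempty (L zero) (ℕₚ.≤-trans (ℕₚ.m≤n+m 1 (deg G zero)) (proj₂ (valid zero)))
  j   = proj₁ nonempty
  j∈L = proj₂ nonempty

enumerates-distinct : ∀ (G : Graph (suc n)) v {a b} → Enumerates G v (a ∷ b ∷ []) → b ≢ a
enumerates-distinct G v e with Unique-resp-↭ (setoid _) (↭⇒↭ₛ (↭-sym e))
       (Uniqueₚ.filter⁺ (λ u → T? (adj G v (punchIn v u))) (Uniqueₚ.allFin⁺ _))
... | (a≢b All.∷ _) ∷ _ = a≢b ∘ sym

-- Rational inequalities and total division

0≤q-p : ∀ {p q} → p ℚ.≤ q → 0ℚ ℚ.≤ q - p
0≤q-p {p} {q} p≤q = subst (ℚ._≤ q - p) (ℚₚ.+-inverseʳ p) (ℚₚ.+-monoˡ-≤ (ℚ.- p) p≤q)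

0≤-* : ∀ {p q} → 0ℚ ℚ.≤ p → 0ℚ ℚ.≤ q → 0ℚ ℚ.≤ p * q
0≤-* {p} {q} 0≤p 0≤q =
  ℚₚ.nonNegative⁻¹ (p * q) {{ℚₚ.nonNeg*nonNeg⇒nonNeg p {{ℚ.nonNegative 0≤p}} q {{ℚ.nonNegative 0≤q}}}}

0≤-+ : ∀ {p q} → 0ℚ ℚ.≤ p → 0ℚ ℚ.≤ q → 0ℚ ℚ.≤ p + q
0≤-+ = ℚₚ.+-mono-≤

-- Reduces an inequality to a certificate: a remainder built from nonnegative pieces and a
-- polynomial identity for the ring solver. Most rational bounds below have this form.
≤-by-diff : ∀ {p q r} → 0ℚ ℚ.≤ r → q ≡ p + r → p ℚ.≤ q
≤-by-diff {p} {q} {r} 0≤r q≡p+r =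
  subst (p ℚ.≤_) (sym q≡p+r) (subst (ℚ._≤ p + r) (ℚₚ.+-identityʳ p) (ℚₚ.+-monoʳ-≤ p 0≤r))

<⇒≢0 : ∀ {q} → 0ℚ ℚ.< q → q ≢ 0ℚ
<⇒≢0 0<q q≡0 = ℚₚ.<⇒≢ 0<q (sym q≡0)

÷₀-*-cancel : ∀ p {q} → q ≢ 0ℚ → (p ÷₀ q) * q ≡ p
÷₀-*-cancel p {q} q≢0 with q ℚₚ.≟ 0ℚ
... | yes q≡0  = contradiction q≡0 q≢0
... | no  q≢0′ = trans (ℚₚ.*-assoc p _ q)
      (trans (cong (p *_) (ℚₚ.*-inverseˡ q {{ℚ.≢-nonZero q≢0′}})) (ℚₚ.*-identityʳ p))

*-cancelʳ-≡ : ∀ {p r} q → q ≢ 0ℚ → p * q ≡ r * q → p ≡ r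
*-cancelʳ-≡ {p} {r} q q≢0 eq = trans (sym (undo p)) (trans (cong (_* q⁻¹) eq) (undo r))
  where
  instance _ = ℚ.≢-nonZero q≢0
  q⁻¹ = ℚ.1/ q
  undo : ∀ x → x * q * q⁻¹ ≡ x
  undo x = trans (ℚₚ.*-assoc x q q⁻¹) (trans (cong (x *_) (ℚₚ.*-inverseʳ q)) (ℚₚ.*-identityʳ x))

÷₀-unique : ∀ {p q r} → q ≢ 0ℚ → p ≡ r * q → p ÷₀ q ≡ r
÷₀-unique {p} {q} q≢0 p≡rq = *-cancelʳ-≡ q q≢0 (trans (÷₀-*-cancel p q≢0) p≡rq)

÷₀-cancelˡ : ∀ {k} p q → k ≢ 0ℚ → (k * p) ÷₀ (k * q) ≡ p ÷₀ q
÷₀-cancelˡ {k} p q k≢0 = by-cases (q ℚₚ.≟ 0ℚ)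
  where
  by-cases : Dec (q ≡ 0ℚ) → (k * p) ÷₀ (k * q) ≡ p ÷₀ q
  -- Both quotients are 0 by the convention for a zero denominator.
  by-cases (yes q≡0) = trans (cong (k * p ÷₀_) (trans (cong (k *_) q≡0) (ℚₚ.*-zeroʳ k))) (cong (p ÷₀_) (sym q≡0))
  by-cases (no  q≢0) = ÷₀-unique kq≢0 (trans (cong (k *_) (sym (÷₀-*-cancel p q≢0)))
      (solve 3 (λ k x q → k :* (x :* q) := x :* (k :* q)) refl k (p ÷₀ q) q))
    where
    kq≢0 : k * q ≢ 0ℚ
    kq≢0 kq≡0 = k≢0 (*-cancelʳ-≡ q q≢0 (trans kq≡0 (sym (ℚₚ.*-zeroˡ q))))

÷₀-≤ : ∀ {p q r} → 0ℚ ℚ.< q → p ℚ.≤ r * q → p ÷₀ q ℚ.≤ r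
÷₀-≤ {p} {q} {r} 0<q p≤rq = ℚₚ.*-cancelʳ-≤-pos q {{ℚ.positive 0<q}}
  (subst (ℚ._≤ r * q) (sym (÷₀-*-cancel p (<⇒≢0 0<q))) p≤rq)

÷₀-≥ : ∀ {p q r} → 0ℚ ℚ.< q → r * q ℚ.≤ p → r ℚ.≤ p ÷₀ q
÷₀-≥ {p} {q} {r} 0<q rq≤p = ℚₚ.*-cancelʳ-≤-pos q {{ℚ.positive 0<q}}
  (subst (r * q ℚ.≤_) (sym (÷₀-*-cancel p (<⇒≢0 0<q))) rq≤p)

-- `fromℕ` normalizes by a gcd, which is stuck on a variable; the explicit fraction lets numerators
-- and denominators reduce.
fromℕ≡mkℚ : ∀ m → fromℕ m ≡ ℚ.mkℚ (+ m) 0 (Coprime.sym (Coprime.1-coprimeTo m))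
fromℕ≡mkℚ m = ℚₚ.normalize-coprime (Coprime.sym (Coprime.1-coprimeTo m))

fromℕ-+ : ∀ m k → fromℕ (m ℕ.+ k) ≡ fromℕ m + fromℕ k
fromℕ-+ m k rewrite fromℕ≡mkℚ m | fromℕ≡mkℚ k =
  cong (_/ 1) (sym (cong₂ ℤ._+_ (ℤₚ.*-identityʳ (+ m)) (ℤₚ.*-identityʳ (+ k))))

0<fromℕ : ∀ {m} → 0 ℕ.< m → 0ℚ ℚ.< fromℕ m
0<fromℕ {suc m} _ = ℚₚ.positive⁻¹ (fromℕ (suc m)) {{ℚₚ.normalize-pos (suc m) 1}}

-- Sums over color lists and products over neighbors

∑-list : Subset 4 → List Color → (Color → ℚ) → ℚ
∑-list S xs f = foldr _+_ 0ℚ (map f (filter (_∈? S) xs))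

∑-cong : ∀ S {f g} → (∀ {j} → j ∈ S → f j ≡ g j) → ∑ S f ≡ ∑ S g
∑-cong S {f} {g} f≡g = go (allFin 4)
  where
  go : ∀ xs → ∑-list S xs f ≡ ∑-list S xs g
  go [] = refl
  go (x ∷ xs) with x ∈? S
  ... | yes x∈S = cong₂ _+_ (f≡g x∈S) (go xs)
  ... | no  _   = go xs

∑-distribˡ : ∀ S k f → ∑ S (λ j → k * f j) ≡ k * ∑ S f
∑-distribˡ S k f = go (allFin 4)
  where
  go : ∀ xs → ∑-list S xs (λ j → k * f j) ≡ k * ∑-list S xs f
  go [] = sym (ℚₚ.*-zeroʳ k)
  go (x ∷ xs) with x ∈? S
  ... | yes x∈S = trans (cong (ℚ._+_ (k * f x)) (go xs)) (sym (ℚₚ.*-distribˡ-+ k (f x) _))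
  ... | no  _   = go xs

∑-support : ∀ S {f} → (∀ {j} → j ∉ S → f j ≡ 0ℚ) → ∑ ⊤ f ≡ ∑ S f
∑-support S {f} f≡0 = go (allFin 4)
  where
  go : ∀ xs → ∑-list ⊤ xs f ≡ ∑-list S xs f
  go [] = refl
  go (x ∷ xs) with x ∈? ⊤
  ... | no  x∉⊤ = contradiction ∈⊤ x∉⊤
  ... | yes _ with x ∈? S
  ...   | yes _   = cong (ℚ._+_ (f x)) (go xs)
  ...   | no  x∉S = trans (cong₂ _+_ (f≡0 x∉S) (go xs)) (ℚₚ.+-identityˡ _)

∏-suc : ∀ m (f : Fin (suc m) → ℚ) → ∏ (suc m) f ≡ f zero * ∏ m (f ∘ suc)
∏-suc m f = cong (λ xs → f zero * foldr _*_ 1ℚ xs)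
  (trans (map-tabulate suc f) (sym (map-tabulate (λ k → k) (f ∘ suc))))

∏-cong : ∀ m {f g : Fin m → ℚ} → (∀ k → f k ≡ g k) → ∏ m f ≡ ∏ m g
∏-cong m f≡g = cong (foldr _*_ 1ℚ) (map-cong f≡g (allFin m))

-- The product of the paper's factors 1 - x_{k,w} along us, in a graph H from
-- which the common neighbor of us has been deleted.
survivalAlong : Estimate → Graph n → Lists n → Color → List (Fin n) → ℚ
survivalAlong p H L w us =
  ∏ (length us) λ k → 1ℚ - p H (strip (take (toℕ k) us) w L) (lookup us k) w

-- From counts to probabilities by telescoping

complement-÷₀ : ∀ a b c → c ≢ 0ℚ → a + b ≡ c → a ≡ c * (1ℚ - b ÷₀ c)
complement-÷₀ a b c c≢0 a+b≡c = begin
  a                       ≡⟨ solve 2 (λ a b → a := a :+ b :- b) refl a b ⟩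
  a + b - b               ≡⟨ cong₂ _-_ a+b≡c (sym (÷₀-*-cancel b c≢0)) ⟩
  c - (b ÷₀ c) * c        ≡⟨ solve 2 (λ c r → c :- r :* c := c :* (con 1ℚ :- r)) refl c (b ÷₀ c) ⟩
  c * (1ℚ - b ÷₀ c)       ∎
  where open ≡-Reasoning

-- For `C = 0` both sides vanish, so the identity also covers stripped lists that admit no proper
-- coloring.
complement-fromℕ : ∀ A B C → A ℕ.+ B ≡ C → fromℕ A ≡ fromℕ C * (1ℚ - fromℕ B ÷₀ fromℕ C)
complement-fromℕ A B zero    A+B≡0 = trans (cong fromℕ (ℕₚ.m+n≡0⇒m≡0 A A+B≡0)) (sym (ℚₚ.*-zeroˡ (1ℚ - fromℕ B ÷₀ 0ℚ)))
complement-fromℕ A B (suc C) A+B≡C =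
  complement-÷₀ (fromℕ A) (fromℕ B) (fromℕ (suc C)) (<⇒≢0 (0<fromℕ {suc C} (s≤s z≤n)))
    (trans (sym (fromℕ-+ A B)) (cong fromℕ A+B≡C))

numProper-Pr : ∀ (G : Graph n) L us u j →
  fromℕ (numProper G (strip (us ++ u ∷ []) j L)) ≡
  fromℕ (numProper G (strip us j L)) * (1ℚ - Pr G (strip us j L) u j)
numProper-Pr G L us u j = complement-fromℕ (numProper G (strip (us ++ u ∷ []) j L))
  (numProperAt G (strip us j L) u j) (numProper G (strip us j L)) (numProper-strip G L us u j)

module _ {A : Set} (# : List A → ℚ) (factor : A → List A → ℚ)
         (#-snoc : ∀ us u → # (us ++ u ∷ []) ≡ # us * factor u us) where

  -- The prefix is arbitrary because the induction moves the head of `us` to the end of `pre`, where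
  -- the next factor sees it as already stripped.
  telescope : ∀ pre us →
    # (pre ++ us) ≡ # pre * ∏ (length us) (λ k → factor (lookup us k) (pre ++ take (toℕ k) us))
  telescope pre [] = trans (cong # (++-identityʳ pre)) (sym (ℚₚ.*-identityʳ (# pre)))
  telescope pre (u ∷ us) = begin
    # (pre ++ u ∷ us)                              ≡⟨ cong # (++-assoc pre (u ∷ []) us) ⟨
    # ((pre ++ u ∷ []) ++ us)                      ≡⟨ telescope (pre ++ u ∷ []) us ⟩
    # (pre ++ u ∷ []) * ∏ (length us) (λ k → factor (lookup us k) ((pre ++ u ∷ []) ++ take (toℕ k) us))
      ≡⟨ cong₂ _*_ (#-snoc pre u) (∏-cong (length us) λ k →
           cong (factor (lookup us k)) (++-assoc pre (u ∷ []) (take (toℕ k) us))) ⟩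
    # pre * factor u pre * rest                    ≡⟨ ℚₚ.*-assoc (# pre) (factor u pre) rest ⟩
    # pre * (factor u pre * rest)                  ≡⟨ cong (λ xs → # pre * (factor u xs * rest)) (++-identityʳ pre) ⟨
    # pre * (factor u (pre ++ []) * rest)          ≡⟨ cong (# pre *_) (∏-suc (length us) (λ k → factor (lookup (u ∷ us) k) (pre ++ take (toℕ k) (u ∷ us)))) ⟨
    # pre * ∏ (suc (length us)) (λ k → factor (lookup (u ∷ us) k) (pre ++ take (toℕ k) (u ∷ us))) ∎
    where
    open ≡-Reasoning
    rest = ∏ (length us) (λ k → factor (lookup us k) (pre ++ u ∷ take (toℕ k) us))

-- The chain rule: each factor is the conditional probability that a vertex of `us` avoids `j`,
-- given that the earlier ones do.
numProper-survival : ∀ (G : Graph n) L j us →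
  fromℕ (numProper G (strip us j L)) ≡ fromℕ (numProper G L) * survivalAlong Pr G L j us
numProper-survival G L j us = telescope (λ xs → fromℕ (numProper G (strip xs j L)))
  (λ u xs → 1ℚ - Pr G (strip xs j L) u j) (λ xs u → numProper-Pr G L xs u j) [] us

fromℕ-sum : ∀ (f : Color → ℕ) → fromℕ (sum (map f (allFin 4))) ≡ ∑ ⊤ (fromℕ ∘ f)
fromℕ-sum f = go (allFin 4)
  where
  go : ∀ xs → fromℕ (sum (map f xs)) ≡ ∑-list ⊤ xs (fromℕ ∘ f)
  go [] = refl
  go (x ∷ xs) with x ∈? ⊤
  ... | no  x∉⊤ = contradiction ∈⊤ x∉⊤
  ... | yes _   = trans (fromℕ-+ (f x) (sum (map f xs))) (cong (ℚ._+_ (fromℕ (f x))) (go xs))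

0÷₀ : ∀ q → 0ℚ ÷₀ q ≡ 0ℚ
0÷₀ q with q ℚₚ.≟ 0ℚ
... | yes _ = refl
... | no  q≢0 = ℚₚ.*-zeroˡ (ℚ.1/_ q {{ℚ.≢-nonZero q≢0}})

Pr-∉ : ∀ (G : Graph n) L v {j} → j ∉ L v → Pr G L v j ≡ 0ℚ
Pr-∉ G L v {j} j∉L =
  trans (cong (λ m → fromℕ m ÷₀ fromℕ (numProper G L)) (numProperAt-∉ G L v j∉L)) (0÷₀ (fromℕ (numProper G L)))

∑-÷₀ : ∀ S f {q} → q ≢ 0ℚ → ∑ S f ≡ q → ∑ S (λ j → f j ÷₀ q) ≡ 1ℚ
∑-÷₀ S f {q} q≢0 total = *-cancelʳ-≡ q q≢0 (begin
  ∑ S (λ j → f j ÷₀ q) * q     ≡⟨ ℚₚ.*-comm (∑ S (λ j → f j ÷₀ q)) q ⟩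
  q * ∑ S (λ j → f j ÷₀ q)     ≡⟨ ∑-distribˡ S q (λ j → f j ÷₀ q) ⟨
  ∑ S (λ j → q * (f j ÷₀ q))   ≡⟨ ∑-cong S (λ {j} _ → trans (ℚₚ.*-comm q (f j ÷₀ q)) (÷₀-*-cancel (f j) q≢0)) ⟩
  ∑ S f                        ≡⟨ total ⟩
  q                            ≡⟨ ℚₚ.*-identityˡ q ⟨
  1ℚ * q                       ∎)
  where open ≡-Reasoning

∑-Pr : ∀ (G : Graph n) L v → Valid G L → ∑ ⊤ (Pr G L v) ≡ 1ℚ
∑-Pr G L v valid = ∑-÷₀ ⊤ (fromℕ ∘ numProperAt G L v) (<⇒≢0 (0<fromℕ (numProper>0 G L valid)))
  (sym (trans (cong fromℕ (numProper-sum G L v)) (fromℕ-sum (numProperAt G L v))))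

-- The common factor `k` cancels, so weights known only up to scale determine the probabilities.
-- Below, `k` is the number of proper colorings of the graph without `v`.
proportional : ∀ S (f : Color → ℕ) (s : Color → ℚ) {N k} → N ≡ sum (map f (allFin 4)) → 0 ℕ.< k →
  (∀ {j} → j ∈ S → fromℕ (f j) ≡ fromℕ k * s j) → (∀ {j} → j ∉ S → f j ≡ 0) →
  ∀ {i} → i ∈ S → fromℕ (f i) ÷₀ fromℕ N ≡ s i ÷₀ ∑ S s
proportional S f s {N} {k} N≡∑ 0<k on off {i} i∈S =
  trans (cong₂ _÷₀_ (on i∈S) total) (÷₀-cancelˡ (s i) (∑ S s) (<⇒≢0 (0<fromℕ 0<k)))
  where
  open ≡-Reasoning
  total : fromℕ N ≡ fromℕ k * ∑ S s
  total = begin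
    fromℕ N                             ≡⟨ cong fromℕ N≡∑ ⟩
    fromℕ (sum (map f (allFin 4)))      ≡⟨ fromℕ-sum f ⟩
    ∑ ⊤ (fromℕ ∘ f)                     ≡⟨ ∑-support S (λ j∉S → cong fromℕ (off j∉S)) ⟩
    ∑ S (fromℕ ∘ f)                     ≡⟨ ∑-cong S on ⟩
    ∑ S (λ j → fromℕ k * s j)           ≡⟨ ∑-distribˡ S (fromℕ k) s ⟩
    fromℕ k * ∑ S s                     ∎

module _ (G : Graph (suc n)) (L : Lists (suc n)) (v : Fin (suc n)) (valid : Valid G L)
         (us : List (Fin n)) (e : Enumerates G v us) where

  private
    H  = delete G v
    Lᵥ = restrict L v
    N₀ = numProper H Lᵥ

    N₀>0 : 0 ℕ.< N₀
    N₀>0 = numProper>0 H Lᵥ (valid-strip G L v valid 0F [] λ ())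

    at : ∀ {j} → j ∈ L v → fromℕ (numProperAt G L v j) ≡ fromℕ N₀ * survivalAlong Pr H Lᵥ j us
    at {j} j∈L = trans (cong fromℕ (numProperAt-delete G L v j e j∈L)) (numProper-survival H Lᵥ j us)

  Pr-recursion : ∀ {i} → i ∈ L v →
    Pr G L v i ≡ survivalAlong Pr H Lᵥ i us ÷₀ ∑ (L v) (λ j → survivalAlong Pr H Lᵥ j us)
  Pr-recursion {i} i∈L = proportional (L v) (numProperAt G L v) (λ j → survivalAlong Pr H Lᵥ j us)
    (numProper-sum G L v) N₀>0 at (numProperAt-∉ G L v) i∈L

-- Inequalities for the degree-2 ratio

≤-const : ∀ p q {p≤q : True (p ℚₚ.≤? q)} → p ℚ.≤ q
≤-const p q {p≤q} = toWitness p≤q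

0≤1-p : ∀ {p q} → p ℚ.≤ q → q ℚ.≤ 1ℚ → 0ℚ ℚ.≤ 1ℚ - p
0≤1-p p≤q q≤1 = 0≤q-p (ℚₚ.≤-trans p≤q q≤1)

≤-complement : ∀ {p q} → p ℚ.≤ q → 1ℚ - q ℚ.≤ 1ℚ - p
≤-complement {p} {q} p≤q = ≤-by-diff (0≤q-p p≤q)
  (solve 2 (λ p q → con 1ℚ :- p := (con 1ℚ :- q) :+ (q :- p)) refl p q)

1≤⇒0< : ∀ {q} → 1ℚ ℚ.≤ q → 0ℚ ℚ.< q
1≤⇒0< = ℚₚ.<-≤-trans (ℚₚ.positive⁻¹ 1ℚ)

-- The factor 1 - f is at least 1 - 4/7 = 3/7.
term-≥ : ∀ f y k → f ℚ.≤ + 4 / 7 → y ℚ.≤ ½ → y ℚ.≤ k → + 3 / 7 * (½ - k) ℚ.≤ (1ℚ - f) * (½ - y)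
term-≥ f y k f≤ y≤½ y≤k = ≤-by-diff
  (0≤-+ (0≤-* (0≤q-p f≤) (0≤q-p y≤½)) (0≤-* (≤-const 0ℚ (+ 3 / 7)) (0≤q-p y≤k)))
  (solve 3 (λ f y k → (con 1ℚ :- f) :* (con ½ :- y) :=
     con (+ 3 / 7) :* (con ½ :- k) :+ ((con (+ 4 / 7) :- f) :* (con ½ :- y) :+ con (+ 3 / 7) :* (k :- y)))
   refl f y k)

-- The ratio (1 - f_i)(1 - y_i) / ∑ⱼ (1 - f_j)(1 - y_j), where x, y, z are
-- the three colors other than i.  The denominator is
-- num + 1 + ½ f_i + excess, so the ratio is ½ exactly if f_i, y_i and
-- excess all vanish.
module Ratio
  (fi fx fy fz yi yx yy yz : ℚ)
  (fi≡ : fi ≡ 1ℚ - (fx + (fy + fz)))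
  (0≤fi : 0ℚ ℚ.≤ fi) (fi≤ : fi ℚ.≤ + 4 / 7)
  (fx≤ : fx ℚ.≤ + 4 / 7) (fy≤ : fy ℚ.≤ + 4 / 7) (fz≤ : fz ℚ.≤ + 4 / 7)
  (0≤yi : 0ℚ ℚ.≤ yi) (yi≤ : yi ℚ.≤ ½)
  (0≤yx : 0ℚ ℚ.≤ yx) (yx≤ : yx ℚ.≤ ½)
  (0≤yy : 0ℚ ℚ.≤ yy) (yy≤ : yy ℚ.≤ ½)
  (0≤yz : 0ℚ ℚ.≤ yz) (yz≤ : yz ℚ.≤ ½) where

  num rest tx ty tz excess ratio : ℚ
  num    = (1ℚ - fi) * (1ℚ - yi)
  rest   = (1ℚ - fx) * (1ℚ - yx) + ((1ℚ - fy) * (1ℚ - yy) + (1ℚ - fz) * (1ℚ - yz))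
  tx     = (1ℚ - fx) * (½ - yx)
  ty     = (1ℚ - fy) * (½ - yy)
  tz     = (1ℚ - fz) * (½ - yz)
  excess = tx + (ty + tz)
  ratio  = num ÷₀ (num + rest)

  private
    4/7≤1 = ≤-const (+ 4 / 7) 1ℚ
    ½≤1   = ≤-const ½ 1ℚ
    0≤1-fi = 0≤1-p fi≤ 4/7≤1
    0≤1-fx = 0≤1-p fx≤ 4/7≤1
    0≤1-fy = 0≤1-p fy≤ 4/7≤1
    0≤1-fz = 0≤1-p fz≤ 4/7≤1

  -- Since the four weights sum to 1, the factors 1 - f over the other three colors sum to 2 + f_i.
  -- Half of that is 1 + ½ f_i, and `excess` collects what each 1 - y adds beyond ½.
  rest≡ : rest ≡ 1ℚ + (½ * fi + excess)
  rest≡ = subst (λ t → rest ≡ 1ℚ + (½ * t + excess)) (sym fi≡)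
    (solve 6 (λ fx fy fz yx yy yz →
      (con 1ℚ :- fx) :* (con 1ℚ :- yx) :+ ((con 1ℚ :- fy) :* (con 1ℚ :- yy) :+ (con 1ℚ :- fz) :* (con 1ℚ :- yz))
      := con 1ℚ :+ (con ½ :* (con 1ℚ :- (fx :+ (fy :+ fz))) :+
           ((con 1ℚ :- fx) :* (con ½ :- yx) :+ ((con 1ℚ :- fy) :* (con ½ :- yy) :+ (con 1ℚ :- fz) :* (con ½ :- yz)))))
     refl fx fy fz yx yy yz)

  0≤tx : 0ℚ ℚ.≤ tx
  0≤tx = 0≤-* 0≤1-fx (0≤q-p yx≤)

  0≤ty : 0ℚ ℚ.≤ ty
  0≤ty = 0≤-* 0≤1-fy (0≤q-p yy≤)

  0≤tz : 0ℚ ℚ.≤ tz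
  0≤tz = 0≤-* 0≤1-fz (0≤q-p yz≤)

  1≤rest : 1ℚ ℚ.≤ rest
  1≤rest = ≤-by-diff {1ℚ} {rest} {½ * fi + excess}
    (0≤-+ (0≤-* (≤-const 0ℚ ½) 0≤fi) (0≤-+ 0≤tx (0≤-+ 0≤ty 0≤tz))) rest≡

  rest≤2+fi : rest ℚ.≤ fromℕ 2 + fi
  rest≤2+fi = ≤-by-diff {rest} {fromℕ 2 + fi} {(1ℚ - fx) * yx + ((1ℚ - fy) * yy + (1ℚ - fz) * yz)}
    (0≤-+ (0≤-* 0≤1-fx 0≤yx) (0≤-+ (0≤-* 0≤1-fy 0≤yy) (0≤-* 0≤1-fz 0≤yz)))
    (subst (λ t → fromℕ 2 + t ≡ rest + ((1ℚ - fx) * yx + ((1ℚ - fy) * yy + (1ℚ - fz) * yz))) (sym fi≡)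
      (solve 6 (λ fx fy fz yx yy yz →
        con (fromℕ 2) :+ (con 1ℚ :- (fx :+ (fy :+ fz))) :=
        (con 1ℚ :- fx) :* (con 1ℚ :- yx) :+ ((con 1ℚ :- fy) :* (con 1ℚ :- yy) :+ (con 1ℚ :- fz) :* (con 1ℚ :- yz))
        :+ ((con 1ℚ :- fx) :* yx :+ ((con 1ℚ :- fy) :* yy :+ (con 1ℚ :- fz) :* yz)))
       refl fx fy fz yx yy yz))

  num≥ : ½ * (1ℚ - fi) ℚ.≤ num
  num≥ = ≤-by-diff (0≤-* 0≤1-fi (0≤q-p yi≤))
    (solve 2 (λ f y → (con 1ℚ :- f) :* (con 1ℚ :- y) := con ½ :* (con 1ℚ :- f) :+ (con 1ℚ :- f) :* (con ½ :- y))
      refl fi yi)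

  num≤1-fi : num ℚ.≤ 1ℚ - fi
  num≤1-fi = ≤-by-diff (0≤-* 0≤1-fi 0≤yi)
    (solve 2 (λ f y → con 1ℚ :- f := (con 1ℚ :- f) :* (con 1ℚ :- y) :+ (con 1ℚ :- f) :* y) refl fi yi)

  num≤1-yi : num ℚ.≤ 1ℚ - yi
  num≤1-yi = ≤-by-diff (0≤-* 0≤fi (0≤1-p yi≤ ½≤1))
    (solve 2 (λ f y → con 1ℚ :- y := (con 1ℚ :- f) :* (con 1ℚ :- y) :+ f :* (con 1ℚ :- y)) refl fi yi)

  num≤1 : num ℚ.≤ 1ℚ
  num≤1 = ℚₚ.≤-trans num≤1-fi (≤-by-diff 0≤fi (solve 1 (λ f → con 1ℚ := (con 1ℚ :- f) :+ f) refl fi))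

  0<total : 0ℚ ℚ.< num + rest
  0<total = 1≤⇒0< (ℚₚ.+-mono-≤ {0ℚ} {num} {1ℚ} {rest}
    (0≤-* 0≤1-fi (0≤1-p yi≤ ½≤1)) 1≤rest)

  -- The worst corner is f_i = 4/7 with y_i = ½ and the other y equal to 0: then `num` is 3/14 and
  -- `rest` is 18/7. The multipliers 12, 1 and 7 weigh the three inequalities that are tight there.
  ratio≥ : + 1 / 13 ℚ.≤ ratio
  ratio≥ = ÷₀-≥ {num} {num + rest} {+ 1 / 13} 0<total (lemma num rest num≥ rest≤2+fi)
    where
    lemma : ∀ n r → ½ * (1ℚ - fi) ℚ.≤ n → r ℚ.≤ fromℕ 2 + fi → + 1 / 13 * (n + r) ℚ.≤ n
    lemma n r n≥ r≤ = ≤-by-diff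
      (0≤-* (≤-const 0ℚ (+ 1 / 13)) (0≤-+ (0≤-+ (0≤-* (≤-const 0ℚ (fromℕ 12)) (0≤q-p n≥)) (0≤q-p r≤))
        (0≤-* (≤-const 0ℚ (fromℕ 7)) (0≤q-p fi≤))))
      (solve 3 (λ n r f → n := con (+ 1 / 13) :* (n :+ r) :+ con (+ 1 / 13) :*
          (con (fromℕ 12) :* (n :- con ½ :* (con 1ℚ :- f)) :+ (con (fromℕ 2) :+ f :- r) :+
           con (fromℕ 7) :* (con (+ 4 / 7) :- f)))
        refl n r fi)

  ratio≤½ : ratio ℚ.≤ ½
  ratio≤½ = ÷₀-≤ {num} {num + rest} {½} 0<total (lemma num rest num≤1 1≤rest)
    where
    lemma : ∀ n r → n ℚ.≤ 1ℚ → 1ℚ ℚ.≤ r → n ℚ.≤ ½ * (n + r)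
    lemma n r n≤ r≥ = ≤-by-diff (0≤-* (≤-const 0ℚ ½) (0≤-+ (0≤q-p n≤) (0≤q-p r≥)))
      (solve 2 (λ n r → con ½ :* (n :+ r) := n :+ con ½ :* ((con 1ℚ :- n) :+ (r :- con 1ℚ))) refl n r)

  -- At `num` = 12/13 and `rest` = 1 the ratio is 12/25, just below 13/27; the constant 1/351 is the
  -- slack that remains.
  ratio≤-num : num ℚ.≤ + 12 / 13 → ratio ℚ.≤ + 13 / 27
  ratio≤-num num≤ = ÷₀-≤ {num} {num + rest} {+ 13 / 27} 0<total (lemma num rest num≤ 1≤rest)
    where
    lemma : ∀ n r → n ℚ.≤ + 12 / 13 → 1ℚ ℚ.≤ r → n ℚ.≤ + 13 / 27 * (n + r)
    lemma n r n≤ r≥ = ≤-by-diff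
      (0≤-+ (0≤-+ (0≤-* (≤-const 0ℚ (+ 13 / 27)) (0≤q-p r≥)) (0≤-* (≤-const 0ℚ (+ 14 / 27)) (0≤q-p n≤)))
        (≤-const 0ℚ (+ 1 / 351)))
      (solve 2 (λ n r → con (+ 13 / 27) :* (n :+ r) :=
          n :+ (con (+ 13 / 27) :* (r :- con 1ℚ) :+ con (+ 14 / 27) :* (con (+ 12 / 13) :- n) :+ con (+ 1 / 351)))
        refl n r)

  -- With `num` at most 1 and `rest` at least 14/13 the bound is exactly 1 / (27/13), which is why
  -- 1/13 is the target for `excess`.
  ratio≤-excess : + 1 / 13 ℚ.≤ excess → ratio ℚ.≤ + 13 / 27
  ratio≤-excess excess≥ = ÷₀-≤ {num} {num + rest} {+ 13 / 27} 0<total (lemma num rest excess num≤1 rest≡ excess≥)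
    where
    lemma : ∀ n r e → n ℚ.≤ 1ℚ → r ≡ 1ℚ + (½ * fi + e) → + 1 / 13 ℚ.≤ e → n ℚ.≤ + 13 / 27 * (n + r)
    lemma n r e n≤ refl e≥ = ≤-by-diff
      (0≤-+ (0≤-+ (0≤-* (≤-const 0ℚ (+ 14 / 27)) (0≤q-p n≤)) (0≤-* (≤-const 0ℚ (+ 13 / 54)) 0≤fi))
        (0≤-* (≤-const 0ℚ (+ 13 / 27)) (0≤q-p e≥)))
      (solve 3 (λ n f e → con (+ 13 / 27) :* (n :+ (con 1ℚ :+ (con ½ :* f :+ e))) :=
          n :+ (con (+ 14 / 27) :* (con 1ℚ :- n) :+ con (+ 13 / 54) :* f :+ con (+ 13 / 27) :* (e :- con (+ 1 / 13))))
        refl n fi e)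

  ratio≡½ : fi ≡ 0ℚ → yi ≡ 0ℚ → yx ≡ ½ → yy ≡ ½ → yz ≡ ½ → ratio ≡ ½
  ratio≡½ fi≡0 yi≡0 yx≡½ yy≡½ yz≡½ = ÷₀-unique {num} {num + rest} {½} (<⇒≢0 0<total)
    (trans num≡1 (sym (cong₂ (λ n r → ½ * (n + r)) num≡1 rest≡1)))
    where
    num≡1 : num ≡ 1ℚ
    num≡1 = cong₂ (λ f y → (1ℚ - f) * (1ℚ - y)) fi≡0 yi≡0
    term≡0 : ∀ f {y} → y ≡ ½ → (1ℚ - f) * (½ - y) ≡ 0ℚ
    term≡0 f refl = ℚₚ.*-zeroʳ (1ℚ - f)
    rest≡1 : rest ≡ 1ℚ
    rest≡1 = trans rest≡ (cong₂ (λ f e → 1ℚ + (½ * f + e)) fi≡0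
      (cong₂ _+_ (term≡0 fx yx≡½) (cong₂ _+_ (term≡0 fy yy≡½) (term≡0 fz yz≡½))))

  -- Each ½ - y is at least 1/26, and the factors in front sum to 2 + f_i, at least 2.
  excess-all : yx ℚ.≤ + 6 / 13 → yy ℚ.≤ + 6 / 13 → yz ℚ.≤ + 6 / 13 → + 1 / 13 ℚ.≤ excess
  excess-all yx≤ yy≤ yz≤ = ≤-by-diff
    {r = + 1 / 26 * fi + ((1ℚ - fx) * (+ 6 / 13 - yx) + ((1ℚ - fy) * (+ 6 / 13 - yy) + (1ℚ - fz) * (+ 6 / 13 - yz)))}
    (0≤-+ (0≤-* (≤-const 0ℚ (+ 1 / 26)) 0≤fi)
      (0≤-+ (0≤-* 0≤1-fx (0≤q-p yx≤)) (0≤-+ (0≤-* 0≤1-fy (0≤q-p yy≤)) (0≤-* 0≤1-fz (0≤q-p yz≤)))))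
    (subst (λ t → excess ≡ + 1 / 13 + (+ 1 / 26 * t + ((1ℚ - fx) * (+ 6 / 13 - yx) + ((1ℚ - fy) * (+ 6 / 13 - yy) + (1ℚ - fz) * (+ 6 / 13 - yz)))))
      (sym fi≡)
      (solve 6 (λ fx fy fz yx yy yz →
        (con 1ℚ :- fx) :* (con ½ :- yx) :+ ((con 1ℚ :- fy) :* (con ½ :- yy) :+ (con 1ℚ :- fz) :* (con ½ :- yz))
        := con (+ 1 / 13) :+ (con (+ 1 / 26) :* (con 1ℚ :- (fx :+ (fy :+ fz))) :+
          ((con 1ℚ :- fx) :* (con (+ 6 / 13) :- yx) :+ ((con 1ℚ :- fy) :* (con (+ 6 / 13) :- yy) :+ (con 1ℚ :- fz) :* (con (+ 6 / 13) :- yz)))))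
       refl fx fy fz yx yy yz))

  -- One vanishing y suffices: its term is at least 3/7 · ½ = 3/14, more than 1/13.
  excess-one-x : yx ℚ.≤ 0ℚ → + 1 / 13 ℚ.≤ excess
  excess-one-x y≤ = ℚₚ.≤-trans (≤-const (+ 1 / 13) (+ 3 / 14 + (0ℚ + 0ℚ)))
    (ℚₚ.+-mono-≤ (term-≥ fx yx 0ℚ fx≤ yx≤ y≤) (ℚₚ.+-mono-≤ 0≤ty 0≤tz))

  excess-one-y : yy ℚ.≤ 0ℚ → + 1 / 13 ℚ.≤ excess
  excess-one-y y≤ = ℚₚ.≤-trans (≤-const (+ 1 / 13) (0ℚ + (+ 3 / 14 + 0ℚ)))
    (ℚₚ.+-mono-≤ 0≤tx (ℚₚ.+-mono-≤ (term-≥ fy yy 0ℚ fy≤ yy≤ y≤) 0≤tz))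

  excess-one-z : yz ℚ.≤ 0ℚ → + 1 / 13 ℚ.≤ excess
  excess-one-z y≤ = ℚₚ.≤-trans (≤-const (+ 1 / 13) (0ℚ + (0ℚ + + 3 / 14)))
    (ℚₚ.+-mono-≤ 0≤tx (ℚₚ.+-mono-≤ 0≤ty (term-≥ fz yz 0ℚ fz≤ yz≤ y≤)))

  -- A single term of size 3/7 · (½ - 2/5) = 3/70 falls short of 1/13, two together exceed it. Hence
  -- one version for each pair of colors.
  excess-two-xy : yx ℚ.≤ + 2 / 5 → yy ℚ.≤ + 2 / 5 → + 1 / 13 ℚ.≤ excess
  excess-two-xy p q = ℚₚ.≤-trans (≤-const (+ 1 / 13) (+ 3 / 70 + (+ 3 / 70 + 0ℚ)))
    (ℚₚ.+-mono-≤ (term-≥ fx yx (+ 2 / 5) fx≤ yx≤ p) (ℚₚ.+-mono-≤ (term-≥ fy yy (+ 2 / 5) fy≤ yy≤ q) 0≤tz))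

  excess-two-xz : yx ℚ.≤ + 2 / 5 → yz ℚ.≤ + 2 / 5 → + 1 / 13 ℚ.≤ excess
  excess-two-xz p q = ℚₚ.≤-trans (≤-const (+ 1 / 13) (+ 3 / 70 + (0ℚ + + 3 / 70)))
    (ℚₚ.+-mono-≤ (term-≥ fx yx (+ 2 / 5) fx≤ yx≤ p) (ℚₚ.+-mono-≤ 0≤ty (term-≥ fz yz (+ 2 / 5) fz≤ yz≤ q)))

  excess-two-yz : yy ℚ.≤ + 2 / 5 → yz ℚ.≤ + 2 / 5 → + 1 / 13 ℚ.≤ excess
  excess-two-yz p q = ℚₚ.≤-trans (≤-const (+ 1 / 13) (0ℚ + (+ 3 / 70 + + 3 / 70)))
    (ℚₚ.+-mono-≤ 0≤tx (ℚₚ.+-mono-≤ (term-≥ fy yy (+ 2 / 5) fy≤ yy≤ p) (term-≥ fz yz (+ 2 / 5) fz≤ yz≤ q)))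

-- The degree-1 ratio for lists of three colors

module Ratio₁ (x y : ℚ) (0≤y : 0ℚ ℚ.≤ y) where

  private
    0<2+y : 0ℚ ℚ.< fromℕ 2 + y
    0<2+y = 1≤⇒0< (≤-by-diff (0≤-+ (≤-const 0ℚ 1ℚ) 0≤y)
      (solve 1 (λ y → con (fromℕ 2) :+ y := con 1ℚ :+ (con 1ℚ :+ y)) refl y))

  ratio₁ : ℚ
  ratio₁ = (1ℚ - x) ÷₀ (fromℕ 2 + y)

  -- The extreme case is x = y = ½, where the ratio is ½ / (5/2) = 1/5.
  ratio₁≥ : x ℚ.≤ ½ → y ℚ.≤ ½ → + 1 / 5 ℚ.≤ ratio₁
  ratio₁≥ x≤ y≤ = ÷₀-≥ {1ℚ - x} {fromℕ 2 + y} 0<2+y (≤-by-diff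
    (0≤-+ (0≤q-p x≤) (0≤-* (≤-const 0ℚ (+ 1 / 5)) (0≤q-p y≤)))
    (solve 2 (λ x y → con 1ℚ :- x := con (+ 1 / 5) :* (con (fromℕ 2) :+ y) :+
        ((con ½ :- x) :+ con (+ 1 / 5) :* (con ½ :- y))) refl x y))

  -- The ratio decreases in both arguments, so it suffices to test `r` at the corner (a , b); for
  -- concrete constants that test is decided by computation.
  ratio₁≤ : ∀ a b r → a ℚ.≤ x → b ℚ.≤ y → 0ℚ ℚ.≤ r → 1ℚ - a ℚ.≤ r * (fromℕ 2 + b) → ratio₁ ℚ.≤ r
  ratio₁≤ a b r a≤x b≤y 0≤r h = ÷₀-≤ {1ℚ - x} {fromℕ 2 + y} 0<2+y (≤-by-diff
    (0≤-+ (0≤q-p h) (0≤-+ (0≤q-p a≤x) (0≤-* 0≤r (0≤q-p b≤y))))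
    (solve 5 (λ x y a b r → r :* (con (fromℕ 2) :+ y) := con 1ℚ :- x :+
        ((r :* (con (fromℕ 2) :+ b) :- (con 1ℚ :- a)) :+ ((x :- a) :+ r :* (y :- b)))) refl x y a b r))

-- Color lists as subsets of four colors

∣b∷p∣ : ∀ {m} b (p : Subset m) → ∣ b Vec.∷ p ∣ ≡ bit b ℕ.+ ∣ p ∣
∣b∷p∣ true  p = refl
∣b∷p∣ false p = refl

member : Subset 4 → Color → ℕ
member S j = bit (Vec.lookup S j)

member-∈ : ∀ {S j} → j ∈ S → member S j ≡ 1
member-∈ j∈S = cong bit ([]=⇒lookup j∈S)

member-∉ : ∀ {S j} → j ∉ S → member S j ≡ 0
member-∉ {S} {j} j∉S with Vec.lookup S j in eq
... | true  = contradiction (lookup⇒[]= j S eq) j∉S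
... | false = refl

size-split : ∀ S i → ∣ S ∣ ≡ member S i ℕ.+
  (member S (punchIn i 0F) ℕ.+ (member S (punchIn i 1F) ℕ.+ member S (punchIn i 2F)))
size-split (a Vec.∷ b Vec.∷ c Vec.∷ d Vec.∷ Vec.[]) i = trans size (reorder i)
  where
  size : ∣ a Vec.∷ b Vec.∷ c Vec.∷ d Vec.∷ Vec.[] ∣ ≡ bit a ℕ.+ (bit b ℕ.+ (bit c ℕ.+ bit d))
  size = trans (∣b∷p∣ a (b Vec.∷ c Vec.∷ d Vec.∷ Vec.[])) (cong (bit a ℕ.+_)
    (trans (∣b∷p∣ b (c Vec.∷ d Vec.∷ Vec.[])) (cong (bit b ℕ.+_)
      (trans (∣b∷p∣ c (d Vec.∷ Vec.[])) (cong (bit c ℕ.+_)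
        (trans (∣b∷p∣ d Vec.[]) (ℕₚ.+-identityʳ (bit d))))))))
  S = a Vec.∷ b Vec.∷ c Vec.∷ d Vec.∷ Vec.[]
  reorder : ∀ i → bit a ℕ.+ (bit b ℕ.+ (bit c ℕ.+ bit d)) ≡ member S i ℕ.+
    (member S (punchIn i 0F) ℕ.+ (member S (punchIn i 1F) ℕ.+ member S (punchIn i 2F)))
  reorder 0F = refl
  reorder 1F = solveᴺ 4 (λ a b c d → a :+ᴺ (b :+ᴺ (c :+ᴺ d)) :=ᴺ b :+ᴺ (a :+ᴺ (c :+ᴺ d))) refl (bit a) (bit b) (bit c) (bit d)
  reorder 2F = solveᴺ 4 (λ a b c d → a :+ᴺ (b :+ᴺ (c :+ᴺ d)) :=ᴺ c :+ᴺ (a :+ᴺ (b :+ᴺ d))) refl (bit a) (bit b) (bit c) (bit d)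
  reorder 3F = solveᴺ 4 (λ a b c d → a :+ᴺ (b :+ᴺ (c :+ᴺ d)) :=ᴺ d :+ᴺ (a :+ᴺ (b :+ᴺ c))) refl (bit a) (bit b) (bit c) (bit d)

size≡3⇒missing : ∀ S → ∣ S ∣ ≡ 3 → ∃ λ m → m ∉ S
size≡3⇒missing S ∣S∣≡3 with 0F ∈? S | 1F ∈? S | 2F ∈? S | 3F ∈? S
... | no ∉ | _ | _ | _ = 0F , ∉
... | yes _ | no ∉ | _ | _ = 1F , ∉
... | yes _ | yes _ | no ∉ | _ = 2F , ∉
... | yes _ | yes _ | yes _ | no ∉ = 3F , ∉
... | yes a | yes b | yes c | yes d = contradiction
      (trans (sym (trans (size-split S 0F) (cong₂ ℕ._+_ (member-∈ a) (cong₂ ℕ._+_ (member-∈ b)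
        (cong₂ ℕ._+_ (member-∈ c) (member-∈ d)))))) ∣S∣≡3) λ ()

∉⇒size≤3 : ∀ S {i} → i ∉ S → ∣ S ∣ ℕ.≤ 3
∉⇒size≤3 S {i} i∉S = subst (ℕ._≤ 3)
  (sym (trans (size-split S i) (cong (ℕ._+ others) (member-∉ i∉S))))
  (ℕₚ.+-mono-≤ (bit≤1 (Vec.lookup S (punchIn i 0F)))
    (ℕₚ.+-mono-≤ (bit≤1 (Vec.lookup S (punchIn i 1F))) (bit≤1 (Vec.lookup S (punchIn i 2F)))))
  where
  others = member S (punchIn i 0F) ℕ.+ (member S (punchIn i 1F) ℕ.+ member S (punchIn i 2F))

  bit≤1 : ∀ b → bit b ℕ.≤ 1
  bit≤1 true  = s≤s z≤n
  bit≤1 false = z≤n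

-- Singles out the color `i` and lists the other three through `punchIn i`, the shape in which
-- `Ratio` takes its arguments.
∑⊤-split : ∀ (g : Color → ℚ) i →
  ∑ ⊤ g ≡ g i + (g (punchIn i 0F) + (g (punchIn i 1F) + g (punchIn i 2F)))
∑⊤-split g 0F = solve 4 (λ a b c d → a :+ (b :+ (c :+ (d :+ con 0ℚ))) := a :+ (b :+ (c :+ d))) refl (g 0F) (g 1F) (g 2F) (g 3F)
∑⊤-split g 1F = solve 4 (λ a b c d → a :+ (b :+ (c :+ (d :+ con 0ℚ))) := b :+ (a :+ (c :+ d))) refl (g 0F) (g 1F) (g 2F) (g 3F)
∑⊤-split g 2F = solve 4 (λ a b c d → a :+ (b :+ (c :+ (d :+ con 0ℚ))) := c :+ (a :+ (b :+ d))) refl (g 0F) (g 1F) (g 2F) (g 3F)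
∑⊤-split g 3F = solve 4 (λ a b c d → a :+ (b :+ (c :+ (d :+ con 0ℚ))) := d :+ (a :+ (b :+ c))) refl (g 0F) (g 1F) (g 2F) (g 3F)

∁⊥≡⊤ : ∀ m → ∁ (⊥ {m}) ≡ ⊤
∁⊥≡⊤ zero    = refl
∁⊥≡⊤ (suc m) = cong (inside Vec.∷_) (∁⊥≡⊤ m)

-- Turns a list of three colors into a term that is closed once the missing color is a numeral, so
-- that `degree1` and `∑` on it compute.
missing⇒complement : ∀ {m} (p : Subset (suc m)) x → ∣ p ∣ ≡ m → x ∉ p → p ≡ ∁ ⁅ x ⁆
missing⇒complement (inside  Vec.∷ p) zero    size x∉p = contradiction here x∉p
missing⇒complement (outside Vec.∷ p) zero    size x∉p =
  cong (outside Vec.∷_) (trans (∣p∣≡n⇒p≡⊤ size) (sym (∁⊥≡⊤ _)))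
missing⇒complement {suc m} (inside  Vec.∷ p) (suc x) size x∉p =
  cong (inside Vec.∷_) (missing⇒complement p x (ℕₚ.suc-injective size) (x∉p ∘ there))
missing⇒complement {suc m} (outside Vec.∷ p) (suc x) size x∉p =
  contradiction (there (subst (x ∈_) (sym (∣p∣≡n⇒p≡⊤ size)) ∈⊤)) x∉p

degree1-three : ∀ q S i m → ∣ S ∣ ≡ 3 → m ∉ S → degree1 q S i ≡ (1ℚ - q i) ÷₀ (fromℕ 2 + q m)
degree1-three q S i m size m∉S rewrite missing⇒complement S m size m∉S = go m
  where
  go : ∀ m → degree1 q (∁ ⁅ m ⁆) i ≡ (1ℚ - q i) ÷₀ (fromℕ 2 + q m)
  go 0F = refl
  go 1F = refl
  go 2F = refl
  go 3F = refl

-- Over three colors 1 - q sums to 3 - (1 - q m). The trailing `* 1ℚ` is how the product along a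
-- single neighbor unfolds.
∑-three : ∀ q S m → ∣ S ∣ ≡ 3 → m ∉ S → ∑ ⊤ q ≡ 1ℚ → ∑ S (λ j → (1ℚ - q j) * 1ℚ) ≡ fromℕ 2 + q m
∑-three q S m size m∉S ∑q≡1 rewrite missing⇒complement S m size m∉S = go m
  where
  identity : ∀ a b c d → d + (a + (b + c)) ≡ 1ℚ →
             (1ℚ - a) * 1ℚ + ((1ℚ - b) * 1ℚ + ((1ℚ - c) * 1ℚ + 0ℚ)) ≡ fromℕ 2 + d
  identity a b c d total = trans
    (solve 4 (λ a b c d → (con 1ℚ :- a) :* con 1ℚ :+ ((con 1ℚ :- b) :* con 1ℚ :+ ((con 1ℚ :- c) :* con 1ℚ :+ con 0ℚ))
        := con (fromℕ 2) :+ d :+ (con 1ℚ :- (d :+ (a :+ (b :+ c))))) refl a b c d)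
    (trans (cong (λ t → fromℕ 2 + d + (1ℚ - t)) total) (ℚₚ.+-identityʳ (fromℕ 2 + d)))
  go : ∀ m → ∑ (∁ ⁅ m ⁆) (λ j → (1ℚ - q j) * 1ℚ) ≡ fromℕ 2 + q m
  go 0F = identity (q 1F) (q 2F) (q 3F) (q 0F) (trans (sym (∑⊤-split q 0F)) ∑q≡1)
  go 1F = identity (q 0F) (q 2F) (q 3F) (q 1F) (trans (sym (∑⊤-split q 1F)) ∑q≡1)
  go 2F = identity (q 0F) (q 1F) (q 3F) (q 2F) (trans (sym (∑⊤-split q 2F)) ∑q≡1)
  go 3F = identity (q 0F) (q 1F) (q 2F) (q 3F) (trans (sym (∑⊤-split q 3F)) ∑q≡1)

∑-four : ∀ q → ∑ ⊤ q ≡ 1ℚ → ∑ ⊤ (λ j → (1ℚ - q j) * 1ℚ) ≡ fromℕ 3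
∑-four q ∑q≡1 = identity (q 0F) (q 1F) (q 2F) (q 3F) (trans (sym (∑⊤-split q 0F)) ∑q≡1)
  where
  identity : ∀ a b c d → a + (b + (c + d)) ≡ 1ℚ →
             (1ℚ - a) * 1ℚ + ((1ℚ - b) * 1ℚ + ((1ℚ - c) * 1ℚ + ((1ℚ - d) * 1ℚ + 0ℚ))) ≡ fromℕ 3
  identity a b c d total = trans
    (solve 4 (λ a b c d → (con 1ℚ :- a) :* con 1ℚ :+ ((con 1ℚ :- b) :* con 1ℚ :+ ((con 1ℚ :- c) :* con 1ℚ :+ ((con 1ℚ :- d) :* con 1ℚ :+ con 0ℚ)))
        := con (fromℕ 4) :- (a :+ (b :+ (c :+ d)))) refl a b c d)
    (cong (λ t → fromℕ 4 - t) total)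

-- Normalized weights on a color list

-- Extension by 0 turns a sum over a list into a sum over all four colors, which can be split at any
-- color, and it agrees with the convention that `f_j` is 0 off the list of `v₁`.
mask : Subset 4 → (Color → ℚ) → Color → ℚ
mask S s j with j ∈? S
... | yes _ = s j
... | no  _ = 0ℚ

mask-∈ : ∀ S s {j} → j ∈ S → mask S s j ≡ s j
mask-∈ S s {j} j∈S with j ∈? S
... | yes _   = refl
... | no  j∉S = contradiction j∈S j∉S

mask-∉ : ∀ S s {j} → j ∉ S → mask S s j ≡ 0ℚ
mask-∉ S s {j} j∉S with j ∈? S
... | yes j∈S = contradiction j∈S j∉S
... | no  _   = refl

∑-mask : ∀ S s → ∑ S s ≡ ∑ ⊤ (mask S s)
∑-mask S s = trans (∑-cong S (λ j∈S → sym (mask-∈ S s j∈S))) (sym (∑-support S (mask-∉ S s)))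

mask-one : ∀ S j → mask S (λ _ → 1ℚ) j ≡ fromℕ (member S j)
mask-one S j with j ∈? S
... | yes j∈S = cong fromℕ (sym (member-∈ j∈S))
... | no  j∉S = cong fromℕ (sym (member-∉ j∉S))

fromℕ-size : ∀ S i → fromℕ ∣ S ∣ ≡ fromℕ (member S i) +
  (fromℕ (member S (punchIn i 0F)) + (fromℕ (member S (punchIn i 1F)) + fromℕ (member S (punchIn i 2F))))
fromℕ-size S i = trans (cong fromℕ (size-split S i))
  (trans (fromℕ-+ (# i) (# x ℕ.+ (# y ℕ.+ # z))) (cong (ℚ._+_ (fromℕ (# i)))
    (trans (fromℕ-+ (# x) (# y ℕ.+ # z)) (cong (ℚ._+_ (fromℕ (# x))) (fromℕ-+ (# y) (# z))))))
  where
  # = member S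
  x = punchIn i 0F
  y = punchIn i 1F
  z = punchIn i 2F

∑-one : ∀ S → ∑ S (λ _ → 1ℚ) ≡ fromℕ ∣ S ∣
∑-one S = trans (∑-mask S (λ _ → 1ℚ)) (trans (∑⊤-split (mask S (λ _ → 1ℚ)) 0F)
  (trans (cong₂ _+_ (mask-one S 0F) (cong₂ _+_ (mask-one S 1F) (cong₂ _+_ (mask-one S 2F) (mask-one S 3F))))
    (sym (fromℕ-size S 0F))))

fromℕ-mono : ∀ {m k} → m ℕ.≤ k → fromℕ m ℚ.≤ fromℕ k
fromℕ-mono {m} {k} m≤k = subst (λ t → fromℕ m ℚ.≤ fromℕ t) (ℕₚ.m+[n∸m]≡n m≤k)
  (≤-by-diff {fromℕ m} {fromℕ (m ℕ.+ (k ℕ.∸ m))} {fromℕ (k ℕ.∸ m)}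
    (ℚₚ.nonNegative⁻¹ (fromℕ (k ℕ.∸ m)) {{ℚₚ.normalize-nonNeg (k ℕ.∸ m) 1}}) (fromℕ-+ m (k ℕ.∸ m)))

-- lo * (k - 1) bounds the total weight of the colors other than j from below,
-- so the normalized weight of j is at most 1 / (1 + ¾) = 4/7.
module Normalized (S : Subset 4) (s : Color → ℚ) (lo : ℚ) (k : ℕ)
  (bounds : ∀ {j} → j ∈ S → lo ℚ.≤ s j × s j ℚ.≤ 1ℚ)
  (¼≤lo : + 1 / 4 ℚ.≤ lo) (k≤∣S∣ : k ℕ.≤ ∣ S ∣) (¾≤ : + 3 / 4 ℚ.≤ lo * (fromℕ k - 1ℚ))
  (nonempty : Nonempty S) where

  a : Color → ℚ
  a = mask S s

  0≤lo : 0ℚ ℚ.≤ lo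
  0≤lo = ℚₚ.≤-trans (≤-const 0ℚ (+ 1 / 4)) ¼≤lo

  0≤a : ∀ j → 0ℚ ℚ.≤ a j
  0≤a j with j ∈? S
  ... | yes j∈S = ℚₚ.≤-trans 0≤lo (proj₁ (bounds j∈S))
  ... | no  _   = ℚₚ.≤-refl

  a≤1 : ∀ j → a j ℚ.≤ 1ℚ
  a≤1 j with j ∈? S
  ... | yes j∈S = proj₂ (bounds j∈S)
  ... | no  _   = ≤-const 0ℚ 1ℚ

  lo*member≤a : ∀ j → lo * fromℕ (member S j) ℚ.≤ a j
  lo*member≤a j with j ∈? S
  ... | yes j∈S = subst (ℚ._≤ s j) (sym (trans (cong (λ m → lo * fromℕ m) (member-∈ j∈S)) (ℚₚ.*-identityʳ lo)))
                    (proj₁ (bounds j∈S))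
  ... | no  j∉S = ℚₚ.≤-reflexive (trans (cong (λ m → lo * fromℕ m) (member-∉ j∉S)) (ℚₚ.*-zeroʳ lo))

  total : ℚ
  total = ∑ S s

  others : Color → ℚ
  others i = a (punchIn i 0F) + (a (punchIn i 1F) + a (punchIn i 2F))

  total≡ : ∀ i → total ≡ a i + others i
  total≡ i = trans (∑-mask S s) (∑⊤-split a i)

  0≤others : ∀ i → 0ℚ ℚ.≤ others i
  0≤others i = 0≤-+ (0≤a (punchIn i 0F)) (0≤-+ (0≤a (punchIn i 1F)) (0≤a (punchIn i 2F)))

  others≤3 : ∀ i → others i ℚ.≤ fromℕ 3
  others≤3 i = ℚₚ.+-mono-≤ (a≤1 (punchIn i 0F)) (ℚₚ.+-mono-≤ (a≤1 (punchIn i 1F)) (a≤1 (punchIn i 2F)))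

  ¾≤others : ∀ {i} → i ∈ S → + 3 / 4 ℚ.≤ others i
  ¾≤others {i} i∈S = ℚₚ.≤-trans ¾≤ (ℚₚ.≤-trans (lemma (fromℕ k) (fromℕ ∣ S ∣) (m (punchIn i 0F)) (m (punchIn i 1F)) (m (punchIn i 2F))
      (fromℕ-mono k≤∣S∣) (trans (fromℕ-size S i) (cong (λ t → fromℕ t + (m (punchIn i 0F) + (m (punchIn i 1F) + m (punchIn i 2F)))) (member-∈ i∈S))))
    (ℚₚ.+-mono-≤ (lo*member≤a (punchIn i 0F)) (ℚₚ.+-mono-≤ (lo*member≤a (punchIn i 1F)) (lo*member≤a (punchIn i 2F)))))
    where
    m : Color → ℚ
    m j = fromℕ (member S j)
    lemma : ∀ k K x y z → k ℚ.≤ K → K ≡ 1ℚ + (x + (y + z)) → lo * (k - 1ℚ) ℚ.≤ lo * x + (lo * y + lo * z)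
    lemma k K x y z k≤K refl = ≤-by-diff (0≤-* 0≤lo (0≤q-p k≤K))
      (solve 5 (λ l k x y z → l :* x :+ (l :* y :+ l :* z) :=
          l :* (k :- con 1ℚ) :+ l :* ((con 1ℚ :+ (x :+ (y :+ z))) :- k)) refl lo k x y z)

  lo≤a : ∀ {i} → i ∈ S → lo ℚ.≤ a i
  lo≤a {i} i∈S = subst (lo ℚ.≤_) (sym (mask-∈ S s i∈S)) (proj₁ (bounds i∈S))

  0<total : 0ℚ ℚ.< total
  0<total = ℚₚ.<-≤-trans (ℚₚ.positive⁻¹ (+ 1 / 4)) (ℚₚ.≤-trans ¼≤lo (ℚₚ.≤-trans (lo≤a (proj₂ nonempty))
    (≤-by-diff {a i} {total} {others i} (0≤others i) (total≡ i))))
    where i = proj₁ nonempty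

  f : Color → ℚ
  f j = a j ÷₀ total

  ∑f≡1 : ∑ ⊤ f ≡ 1ℚ
  ∑f≡1 = ∑-÷₀ ⊤ a (<⇒≢0 0<total) (sym (∑-mask S s))

  f∉ : ∀ {j} → j ∉ S → f j ≡ 0ℚ
  f∉ j∉S = trans (cong (_÷₀ total) (mask-∉ S s j∉S)) (0÷₀ total)

  0≤f : ∀ j → 0ℚ ℚ.≤ f j
  0≤f j = ÷₀-≥ {a j} {total} {0ℚ} 0<total (subst (ℚ._≤ a j) (sym (ℚₚ.*-zeroˡ total)) (0≤a j))

  f≤4/7 : ∀ j → f j ℚ.≤ + 4 / 7
  f≤4/7 j = by-cases (j ∈? S)
    where
    lemma : ∀ x o t → t ≡ x + o → x ℚ.≤ 1ℚ → + 3 / 4 ℚ.≤ o → x ℚ.≤ + 4 / 7 * t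
    lemma x o t refl x≤1 o≥ = ≤-by-diff
      (0≤-+ (0≤-* (≤-const 0ℚ (+ 3 / 7)) (0≤q-p x≤1)) (0≤-* (≤-const 0ℚ (+ 4 / 7)) (0≤q-p o≥)))
      (solve 2 (λ x o → con (+ 4 / 7) :* (x :+ o) :=
          x :+ (con (+ 3 / 7) :* (con 1ℚ :- x) :+ con (+ 4 / 7) :* (o :- con (+ 3 / 4)))) refl x o)
    by-cases : Dec (j ∈ S) → f j ℚ.≤ + 4 / 7
    by-cases (yes j∈S) = ÷₀-≤ {a j} {total} {+ 4 / 7} 0<total
      (lemma (a j) (others j) total (total≡ j) (a≤1 j) (¾≤others j∈S))
    by-cases (no  j∉S) = subst (ℚ._≤ + 4 / 7) (sym (f∉ j∉S)) (≤-const 0ℚ (+ 4 / 7))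

  -- A listed color has weight at least ¼ against at most 3 from the other colors.
  1/13≤f : ∀ {j} → j ∈ S → + 1 / 13 ℚ.≤ f j
  1/13≤f {j} j∈S = ÷₀-≥ {a j} {total} {+ 1 / 13} 0<total
    (lemma (a j) (others j) total (total≡ j) (ℚₚ.≤-trans ¼≤lo (lo≤a j∈S)) (others≤3 j))
    where
    lemma : ∀ x o t → t ≡ x + o → + 1 / 4 ℚ.≤ x → o ℚ.≤ fromℕ 3 → + 1 / 13 * t ℚ.≤ x
    lemma x o t refl x≥ o≤ = ≤-by-diff
      (0≤-+ (0≤-* (≤-const 0ℚ (+ 12 / 13)) (0≤q-p x≥)) (0≤-* (≤-const 0ℚ (+ 1 / 13)) (0≤q-p o≤)))
      (solve 2 (λ x o → x := con (+ 1 / 13) :* (x :+ o) :+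
          (con (+ 12 / 13) :* (x :- con (+ 1 / 4)) :+ con (+ 1 / 13) :* (con (fromℕ 3) :- o))) refl x o)

-- Bounds carried through the recursion

-- A reachable vertex with at most three colors has degree at most 1, which excludes the degree-2
-- step and improves 1/13 to 1/5. The improvement is needed when `v₂` has one further neighbor off
-- the triangle, where 1/13 leaves too little `excess`.
record Good (p : Estimate) : Set where
  field
    outside-list : ∀ {n} (G : Graph n) L v {i} → i ∉ L v → p G L v i ≡ 0ℚ
    lower        : ∀ {n} (G : Graph n) L v {i} → Reachable G L v → i ∈ L v → + 1 / 13 ℚ.≤ p G L v i
    lower₃       : ∀ {n} (G : Graph n) L v {i} → Reachable G L v → i ∈ L v → ∣ L v ∣ ℕ.≤ 3 → + 1 / 5 ℚ.≤ p G L v i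
    upper        : ∀ {n} (G : Graph n) L v i → Reachable G L v → p G L v i ℚ.≤ ½

  nonneg : ∀ {n} (G : Graph n) L v i → Reachable G L v → 0ℚ ℚ.≤ p G L v i
  nonneg G L v i reach = by-cases (i ∈? L v)
    where
    by-cases : Dec (i ∈ L v) → 0ℚ ℚ.≤ p G L v i
    by-cases (yes i∈L) = ℚₚ.≤-trans (≤-const 0ℚ (+ 1 / 13)) (lower G L v reach i∈L)
    by-cases (no  i∉L) = ℚₚ.≤-reflexive (sym (outside-list G L v i∉L))

record NormalizedBounds (S : Subset 4) (f : Color → ℚ) : Set where
  field
    total   : ∑ ⊤ f ≡ 1ℚ
    nonneg  : ∀ j → 0ℚ ℚ.≤ f j
    upper   : ∀ j → f j ℚ.≤ + 4 / 7
    lower   : ∀ {j} → j ∈ S → + 1 / 13 ℚ.≤ f j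
    off     : ∀ {j} → j ∉ S → f j ≡ 0ℚ

½≤1-x : ∀ {x} → x ℚ.≤ ½ → ½ ℚ.≤ 1ℚ - x
½≤1-x x≤½ = ≤-complement x≤½

1-x≤1 : ∀ {x} → 0ℚ ℚ.≤ x → 1ℚ - x ℚ.≤ 1ℚ
1-x≤1 0≤x = ≤-complement 0≤x

∏₁-bounds : ∀ a → ½ ℚ.≤ a → a ℚ.≤ 1ℚ → ½ ℚ.≤ a * 1ℚ × a * 1ℚ ℚ.≤ 1ℚ
∏₁-bounds a ½≤a a≤1 rewrite ℚₚ.*-identityʳ a = ½≤a , a≤1

∏₂-bounds : ∀ a b → ½ ℚ.≤ a → a ℚ.≤ 1ℚ → ½ ℚ.≤ b → b ℚ.≤ 1ℚ →
            + 1 / 4 ℚ.≤ a * (b * 1ℚ) × a * (b * 1ℚ) ℚ.≤ 1ℚ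
∏₂-bounds a b ½≤a a≤1 ½≤b b≤1 =
  ≤-by-diff (0≤-+ (0≤-* (0≤q-p ½≤a) (ℚₚ.≤-trans (≤-const 0ℚ ½) ½≤b)) (0≤-* (≤-const 0ℚ ½) (0≤q-p ½≤b)))
    (solve 2 (λ a b → a :* (b :* con 1ℚ) := con (+ 1 / 4) :+ ((a :- con ½) :* b :+ con ½ :* (b :- con ½))) refl a b) ,
  ≤-by-diff (0≤-+ (0≤-* (0≤q-p a≤1) (ℚₚ.≤-trans (≤-const 0ℚ ½) ½≤b)) (0≤q-p b≤1))
    (solve 2 (λ a b → con 1ℚ := a :* (b :* con 1ℚ) :+ ((con 1ℚ :- a) :* b :+ (con 1ℚ :- b))) refl a b)

module _ (p : Estimate) (good : Good p) (H : Graph (suc n)) (L : Lists (suc n)) (v₁ : Fin (suc n))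
         (reach : Reachable H L v₁) where

  open Good good

  private
    H′ = delete H v₁
    L′ = restrict L v₁

    size≥ : deg H v₁ ℕ.+ 2 ℕ.≤ ∣ L v₁ ∣
    size≥ = proj₂ (proj₂ reach)

    nonempty : Nonempty (L v₁)
    nonempty = 0<∣p∣⇒nonempty (L v₁) (ℕₚ.≤-trans (s≤s z≤n) (ℕₚ.≤-trans (ℕₚ.m≤n+m 2 (deg H v₁)) size≥))

    factor : ∀ (pre : List (Fin n)) → (∀ {u} → u ∈ᴸ pre → T (adj H v₁ (punchIn v₁ u))) →
             ∀ u → T (adj H v₁ (punchIn v₁ u)) → u ∉ᴸ pre → ∀ w →
             let x = p H′ (strip pre w L′) u w in ½ ℚ.≤ 1ℚ - x × 1ℚ - x ℚ.≤ 1ℚ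
    factor pre adjacent u a u∉pre w =
      ½≤1-x (upper H′ (strip pre w L′) u w r) , 1-x≤1 (nonneg H′ (strip pre w L′) u w r)
      where
      r : Reachable H′ (strip pre w L′) u
      r = reachable-strip H L v₁ (proj₁ reach) w pre adjacent u a u∉pre

  -- With d further neighbors the weights are products of d factors in [½, 1], hence at least 1, ½
  -- or ¼, while the list has at least d + 2 colors. The other colors thus weigh at least 1 · 1, ½ ·
  -- 2 or ¼ · 3, never less than ¾.
  normalized-bounds : ∀ us → Enumerates H v₁ us → (s : Color → ℚ) →
    (∀ w → s w ≡ survivalAlong p H′ L′ w us) →
    NormalizedBounds (L v₁) (λ j → mask (L v₁) s j ÷₀ ∑ (L v₁) s)
  normalized-bounds us e s s≡ = go us e s≡
    where
    package : ∀ lo k → (∀ w → lo ℚ.≤ s w × s w ℚ.≤ 1ℚ) → + 1 / 4 ℚ.≤ lo → k ℕ.≤ ∣ L v₁ ∣ →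
              + 3 / 4 ℚ.≤ lo * (fromℕ k - 1ℚ) → NormalizedBounds (L v₁) (λ j → mask (L v₁) s j ÷₀ ∑ (L v₁) s)
    package lo k b ¼≤lo k≤ ¾≤ = record
      { total = N.∑f≡1 ; nonneg = N.0≤f ; upper = N.f≤4/7 ; lower = N.1/13≤f ; off = N.f∉ }
      where module N = Normalized (L v₁) s lo k (λ {w} _ → b w) ¼≤lo k≤ ¾≤ nonempty

    go : ∀ us → Enumerates H v₁ us → (∀ w → s w ≡ survivalAlong p H′ L′ w us) →
         NormalizedBounds (L v₁) (λ j → mask (L v₁) s j ÷₀ ∑ (L v₁) s)
    go [] e s≡ = package 1ℚ 2 (λ w → ℚₚ.≤-reflexive (sym (s≡ w)) , ℚₚ.≤-reflexive (s≡ w))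
      (≤-const (+ 1 / 4) 1ℚ) (subst (λ d → d ℕ.+ 2 ℕ.≤ ∣ L v₁ ∣) (sym (length-enumerates H v₁ e)) size≥)
      (≤-const (+ 3 / 4) 1ℚ)
    go (u ∷ []) e s≡ = package ½ 3 bounds
      (≤-const (+ 1 / 4) ½) (subst (λ d → d ℕ.+ 2 ℕ.≤ ∣ L v₁ ∣) (sym (length-enumerates H v₁ e)) size≥)
      (≤-const (+ 3 / 4) 1ℚ)
      where
      bounds : ∀ w → ½ ℚ.≤ s w × s w ℚ.≤ 1ℚ
      bounds w rewrite s≡ w =
        let (l , h) = factor [] (λ ()) u (enumerates⁻ H v₁ e (here refl)) (λ ()) w in
        ∏₁-bounds (1ℚ - p H′ L′ u w) l h
    go (u ∷ u′ ∷ []) e s≡ = package (+ 1 / 4) 4 bounds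
      (≤-const (+ 1 / 4) (+ 1 / 4)) (subst (λ d → d ℕ.+ 2 ℕ.≤ ∣ L v₁ ∣) (sym (length-enumerates H v₁ e)) size≥)
      (≤-const (+ 3 / 4) (+ 3 / 4))
      where
      adjacent : ∀ {x} → x ∈ᴸ u ∷ [] → T (adj H v₁ (punchIn v₁ x))
      adjacent (here refl) = enumerates⁻ H v₁ e (here refl)
      fresh : u′ ∉ᴸ u ∷ []
      fresh (here u′≡u) = enumerates-distinct H v₁ e u′≡u
      bounds : ∀ w → + 1 / 4 ℚ.≤ s w × s w ℚ.≤ 1ℚ
      bounds w rewrite s≡ w =
        let (l , h)   = factor [] (λ ()) u (enumerates⁻ H v₁ e (here refl)) (λ ()) w
            (l′ , h′) = factor (u ∷ []) adjacent u′ (enumerates⁻ H v₁ e (there (here refl))) fresh w in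
        ∏₂-bounds (1ℚ - p H′ L′ u w) (1ℚ - p H′ (strip (u ∷ []) w L′) u′ w) l h l′ h′
    go (_ ∷ _ ∷ _ ∷ us) e s≡ = contradiction
      (subst (ℕ._≤ 2) (sym (length-enumerates H v₁ e)) (proj₁ (proj₂ reach))) λ { (s≤s (s≤s ())) }

-- Unfolding the procedure

module Recursion (ω : Ordering) where
  open Ordering ω

  step-nil : ∀ (p : Estimate) (G : Graph (suc n)) L v i → fixed G v ≡ [] → step ω p G L v i ≡ 1ℚ ÷₀ fromℕ ∣ L v ∣
  step-nil p G L v i eq rewrite eq = refl

  step-one : ∀ (p : Estimate) (G : Graph (suc n)) L v i {v₁} → fixed G v ≡ v₁ ∷ [] →
             step ω p G L v i ≡ degree1 (p (delete G v) (restrict L v) v₁) (L v) i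
  step-one p G L v i eq rewrite eq = refl

  step-two : ∀ (p : Estimate) (G : Graph (suc n)) L v i {a b} → fixed G v ≡ a ∷ b ∷ [] →
             let (v₁ , v₂) = paired G L v i a b in step ω p G L v i ≡ degree2 ω p G L v i v₁ v₂
  step-two p G L v i eq rewrite eq = refl

  P-∉ : ∀ (G : Graph n) L v {i} D → i ∉ L v → P ω G L v i D ≡ 0ℚ
  P-∉ G L v {i} D i∉L with i ∈? L v
  ... | yes i∈L = contradiction i∈L i∉L
  ... | no  _   = refl

  P-zero : ∀ (G : Graph n) L v {i} → i ∈ L v → P ω G L v i (+ 0) ≡ 1ℚ ÷₀ fromℕ ∣ L v ∣
  P-zero G L v {i} i∈L with i ∈? L v
  ... | yes _   = refl
  ... | no  i∉L = contradiction i∈L i∉L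

  Pᴰ : ℕ → Estimate
  Pᴰ D G L v i = P ω G L v i (+ D)

  P-suc : ∀ (G : Graph n) L v {i} D → i ∈ L v → P ω G L v i (+ suc D) ≡ step ω (Pᴰ D) G L v i
  P-suc G L v {i} D i∈L with i ∈? L v
  ... | yes _   = refl
  ... | no  i∉L = contradiction i∈L i∉L

  module _ (p : Estimate) (G : Graph (suc (suc n))) (L : Lists (suc (suc n))) (v : Fin (suc (suc n)))
           (i : Color) (v₁ v₂ : Fin (suc n)) where

    private
      H  = delete G v
      Lᵥ = restrict L v

    -- `f₂` recasts the local `f` of `degree2` as a masked weight over its total, the form that
    -- `Normalized` bounds; off the list both are 0.
    f₂ y₂ : Color → ℚ
    f₂ j = mask (Lᵥ v₁) (survival ω p H Lᵥ v₁) j ÷₀ ∑ (Lᵥ v₁) (survival ω p H Lᵥ v₁)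
    y₂ j = p H (strip (v₁ ∷ []) j Lᵥ) v₂ j

    private
      -- Gives a name to the terms of the sum in degree2, whose f is local.
      local : Σ ℚ λ num → Σ (Color → ℚ) λ g → degree2 ω p G L v i v₁ v₂ ≡ num ÷₀ ∑ (L v) g
      local = _ , _ , refl

      g : Color → ℚ
      g = proj₁ (proj₂ local)

      g≡ : ∀ j → g j ≡ (1ℚ - f₂ j) * (1ℚ - y₂ j)
      g≡ j with j ∈? Lᵥ v₁
      ... | yes _ = refl
      ... | no  _ = cong (λ t → (1ℚ - t) * (1ℚ - y₂ j)) (sym (0÷₀ (∑ (Lᵥ v₁) (survival ω p H Lᵥ v₁))))

    degree2≡ : degree2 ω p G L v i v₁ v₂ ≡
      ((1ℚ - f₂ i) * (1ℚ - y₂ i)) ÷₀ ∑ (L v) (λ j → (1ℚ - f₂ j) * (1ℚ - y₂ j))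
    degree2≡ = cong₂ _÷₀_ (g≡ i) (∑-cong (L v) λ {j} _ → g≡ j)

-- Bounds at every depth

one-sided : ∀ {a b} → a + b ≡ 1ℚ → a ≡ 1ℚ - b
one-sided {a} {b} a+b≡1 = trans (solve 2 (λ a b → a := a :+ b :- b) refl a b) (cong (_- b) a+b≡1)

Bounds : Subset 4 → ℚ → Set
Bounds S t = + 1 / 13 ℚ.≤ t × (∣ S ∣ ℕ.≤ 3 → + 1 / 5 ℚ.≤ t) × t ℚ.≤ ½

reciprocal-bounds : ∀ S → 2 ℕ.≤ ∣ S ∣ → Bounds S (1ℚ ÷₀ fromℕ ∣ S ∣)
reciprocal-bounds S 2≤∣S∣ = go ∣ S ∣ 2≤∣S∣ (∣p∣≤n S)
  where
  go : ∀ k → 2 ℕ.≤ k → k ℕ.≤ 4 → + 1 / 13 ℚ.≤ 1ℚ ÷₀ fromℕ k × (k ℕ.≤ 3 → + 1 / 5 ℚ.≤ 1ℚ ÷₀ fromℕ k) × 1ℚ ÷₀ fromℕ k ℚ.≤ ½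
  go 1 (s≤s ()) _
  go 2 _ _ = ≤-const (+ 1 / 13) ½ , (λ _ → ≤-const (+ 1 / 5) ½) , ≤-const ½ ½
  go 3 _ _ = ≤-const (+ 1 / 13) (+ 1 / 3) , (λ _ → ≤-const (+ 1 / 5) (+ 1 / 3)) , ≤-const (+ 1 / 3) ½
  go 4 _ _ = ≤-const (+ 1 / 13) (+ 1 / 4) , (λ _ → ≤-const (+ 1 / 5) (+ 1 / 4)) , ≤-const (+ 1 / 4) ½
  go (suc (suc (suc (suc (suc _))))) _ (s≤s (s≤s (s≤s (s≤s ()))))

size-cases : ∀ (S : Subset 4) → 3 ℕ.≤ ∣ S ∣ → ∣ S ∣ ≡ 3 ⊎ S ≡ ⊤
size-cases S 3≤∣S∣ with ℕₚ.m≤n⇒m<n∨m≡n 3≤∣S∣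
... | inj₁ 4≤∣S∣ = inj₂ (∣p∣≡n⇒p≡⊤ (ℕₚ.≤-antisym (∣p∣≤n S) 4≤∣S∣))
... | inj₂ 3≡∣S∣ = inj₁ (sym 3≡∣S∣)

third-bounds : ∀ x → 0ℚ ℚ.≤ x → x ℚ.≤ ½ → + 1 / 13 ℚ.≤ (1ℚ - x) ÷₀ fromℕ 3 × (1ℚ - x) ÷₀ fromℕ 3 ℚ.≤ + 13 / 27
third-bounds x 0≤x x≤½ =
  ÷₀-≥ {1ℚ - x} {fromℕ 3} {+ 1 / 13} 0<3 (ℚₚ.≤-trans (≤-const (+ 1 / 13 * fromℕ 3) ½) (½≤1-x x≤½)) ,
  ÷₀-≤ {1ℚ - x} {fromℕ 3} {+ 13 / 27} 0<3 (ℚₚ.≤-trans (1-x≤1 0≤x) (≤-const 1ℚ (+ 13 / 27 * fromℕ 3)))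
  where
  0<3 : 0ℚ ℚ.< fromℕ 3
  0<3 = 0<fromℕ {3} (s≤s z≤n)

two-of-three : ∀ S i → i ∉ S → 2 ℕ.≤ ∣ S ∣ →
  (punchIn i 0F ∈ S × punchIn i 1F ∈ S) ⊎ (punchIn i 0F ∈ S × punchIn i 2F ∈ S) ⊎ (punchIn i 1F ∈ S × punchIn i 2F ∈ S)
two-of-three S i i∉S 2≤∣S∣ with punchIn i 0F ∈? S | punchIn i 1F ∈? S | punchIn i 2F ∈? S
... | yes x∈ | yes y∈ | _      = inj₁ (x∈ , y∈)
... | yes x∈ | no _   | yes z∈ = inj₂ (inj₁ (x∈ , z∈))
... | no _   | yes y∈ | yes z∈ = inj₂ (inj₂ (y∈ , z∈))
... | yes x∈ | no y∉  | no z∉  = contradiction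
      (subst (2 ℕ.≤_) (trans (size-split S i) (cong₂ ℕ._+_ (member-∉ i∉S) (cong₂ ℕ._+_ (member-∈ x∈) (cong₂ ℕ._+_ (member-∉ y∉) (member-∉ z∉))))) 2≤∣S∣)
      λ { (s≤s ()) }
... | no x∉  | yes y∈ | no z∉  = contradiction
      (subst (2 ℕ.≤_) (trans (size-split S i) (cong₂ ℕ._+_ (member-∉ i∉S) (cong₂ ℕ._+_ (member-∉ x∉) (cong₂ ℕ._+_ (member-∈ y∈) (member-∉ z∉))))) 2≤∣S∣)
      λ { (s≤s ()) }
... | no x∉  | no y∉  | yes z∈ = contradiction
      (subst (2 ℕ.≤_) (trans (size-split S i) (cong₂ ℕ._+_ (member-∉ i∉S) (cong₂ ℕ._+_ (member-∉ x∉) (cong₂ ℕ._+_ (member-∉ y∉) (member-∈ z∈))))) 2≤∣S∣)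
      λ { (s≤s ()) }
... | no x∉  | no y∉  | no z∉  = contradiction
      (subst (2 ℕ.≤_) (trans (size-split S i) (cong₂ ℕ._+_ (member-∉ i∉S) (cong₂ ℕ._+_ (member-∉ x∉) (cong₂ ℕ._+_ (member-∉ y∉) (member-∉ z∉))))) 2≤∣S∣)
      λ ()

module _ (G : Graph (suc n)) (L : Lists (suc n)) (v : Fin (suc n)) (reach : Reachable G L v) where

  list-size : ∀ {us} → Enumerates G v us → length us ℕ.+ 2 ℕ.≤ ∣ L v ∣
  list-size e = subst (λ d → d ℕ.+ 2 ℕ.≤ ∣ L v ∣) (sym (length-enumerates G v e)) (proj₂ (proj₂ reach))

  reachable-delete : ∀ v₁ → T (adj G v (punchIn v v₁)) → Reachable (delete G v) (restrict L v) v₁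
  reachable-delete v₁ a = reachable-strip G L v (proj₁ reach) 0F [] (λ ()) v₁ a λ ()

  at-most-two : ∀ {a b c us} → ¬ Enumerates G v (a ∷ b ∷ c ∷ us)
  at-most-two e = contradiction
    (subst (ℕ._≤ 2) (sym (length-enumerates G v e)) (proj₁ (proj₂ reach))) λ { (s≤s (s≤s ())) }

module EstimateBounds (ω : Ordering) where
  open Ordering ω
  open Recursion ω

  module Degree2 (p : Estimate) (good : Good p) (G : Graph (suc (suc n))) (L : Lists (suc (suc n)))
                 (v : Fin (suc (suc n))) (reach : Reachable G L v) (i : Color)
                 (v₁ v₂ : Fin (suc n)) (e : Enumerates G v (v₁ ∷ v₂ ∷ [])) where

    H  = delete G v
    Lᵥ = restrict L v

    adj₁ : T (adj G v (punchIn v v₁))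
    adj₁ = enumerates⁻ G v e (here refl)

    adj₂ : T (adj G v (punchIn v v₂))
    adj₂ = enumerates⁻ G v e (there (here refl))

    v₂∉ : v₂ ∉ᴸ v₁ ∷ []
    v₂∉ (here v₂≡v₁) = enumerates-distinct G v e v₂≡v₁

    adjacent : ∀ {u} → u ∈ᴸ v₁ ∷ [] → T (adj G v (punchIn v u))
    adjacent (here refl) = adj₁

    strip-v₂ : ∀ j → strip (v₁ ∷ []) j Lᵥ v₂ ≡ Lᵥ v₂
    strip-v₂ j = strip-∉ Lᵥ (v₁ ∷ []) j v₂ v₂∉

    reach₂ : ∀ j → Reachable H (strip (v₁ ∷ []) j Lᵥ) v₂
    reach₂ j = reachable-strip G L v (proj₁ reach) j (v₁ ∷ []) adjacent v₂ adj₂ v₂∉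

    -- Degree 2 and a surplus of 2 force all four colors, so the sum at `v` meets the full total of
    -- the weights `f`.
    L≡⊤ : L v ≡ ⊤
    L≡⊤ = ∣p∣≡n⇒p≡⊤ (ℕₚ.≤-antisym (∣p∣≤n (L v)) (list-size G L v reach e))

    f y : Color → ℚ
    f = f₂ p G L v i v₁ v₂
    y = y₂ p G L v i v₁ v₂

    module F = NormalizedBounds (normalized-bounds p good H Lᵥ v₁ (reachable-delete G L v reach v₁ adj₁)
      (fixed H v₁) (fixed-↭ H v₁) (survival ω p H Lᵥ v₁) (λ _ → refl))

    0≤y : ∀ j → 0ℚ ℚ.≤ y j
    0≤y j = Good.nonneg good H (strip (v₁ ∷ []) j Lᵥ) v₂ j (reach₂ j)

    y≤½ : ∀ j → y j ℚ.≤ ½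
    y≤½ j = Good.upper good H (strip (v₁ ∷ []) j Lᵥ) v₂ j (reach₂ j)

    x′ y′ z′ : Color
    x′ = punchIn i 0F
    y′ = punchIn i 1F
    z′ = punchIn i 2F

    module R = Ratio (f i) (f x′) (f y′) (f z′) (y i) (y x′) (y y′) (y z′)
      (one-sided {f i} {f x′ + (f y′ + f z′)} (trans (sym (∑⊤-split f i)) F.total))
      (F.nonneg i) (F.upper i) (F.upper x′) (F.upper y′) (F.upper z′)
      (0≤y i) (y≤½ i) (0≤y x′) (y≤½ x′) (0≤y y′) (y≤½ y′) (0≤y z′) (y≤½ z′)

    degree2≡ratio : degree2 ω p G L v i v₁ v₂ ≡ R.ratio
    degree2≡ratio = trans (degree2≡ p G L v i v₁ v₂) (cong (((1ℚ - f i) * (1ℚ - y i)) ÷₀_)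
      (trans (cong (λ S → ∑ S (λ j → (1ℚ - f j) * (1ℚ - y j))) L≡⊤) (∑⊤-split (λ j → (1ℚ - f j) * (1ℚ - y j)) i)))

    ratio≤-∈₁ : i ∈ Lᵥ v₁ → R.ratio ℚ.≤ + 13 / 27
    ratio≤-∈₁ i∈ = R.ratio≤-num (ℚₚ.≤-trans R.num≤1-fi (≤-complement (F.lower i∈)))

    ratio≤-∈₂ : i ∈ Lᵥ v₂ → R.ratio ℚ.≤ + 13 / 27
    ratio≤-∈₂ i∈ = R.ratio≤-num (ℚₚ.≤-trans R.num≤1-yi (≤-complement
      (Good.lower good H (strip (v₁ ∷ []) i Lᵥ) v₂ (reach₂ i) (subst (i ∈_) (sym (strip-v₂ i)) i∈))))

  pair-enumerates : ∀ (G : Graph (suc n)) L v i {a b} → fixed G v ≡ a ∷ b ∷ [] →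
    let (v₁ , v₂) = paired G L v i a b in Enumerates G v (v₁ ∷ v₂ ∷ [])
  pair-enumerates G L v i eq =
    ↭-trans (paired-↭ G L v i _ _ eq) (subst (_↭ neighbors G v) eq (fixed-↭ G v))

  module _ (p : Estimate) (good : Good p) where
    open Good good

    degree1-bounds : ∀ (G : Graph (suc n)) L v {v₁} → Reachable G L v → Enumerates G v (v₁ ∷ []) → ∀ i →
      Bounds (L v) (degree1 (p (delete G v) (restrict L v) v₁) (L v) i)
    degree1-bounds G L v {v₁} reach e i = by-size (size-cases (L v) (list-size G L v reach e))
      where
      reach₁ : Reachable (delete G v) (restrict L v) v₁
      reach₁ = reachable-delete G L v reach v₁ (enumerates⁻ G v e (here refl))
      q : Color → ℚ
      q = p (delete G v) (restrict L v) v₁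
      0≤q : ∀ j → 0ℚ ℚ.≤ q j
      0≤q j = nonneg (delete G v) (restrict L v) v₁ j reach₁
      q≤½ : ∀ j → q j ℚ.≤ ½
      q≤½ j = upper (delete G v) (restrict L v) v₁ j reach₁

      four : ∀ {S} → S ≡ ⊤ → Bounds S (degree1 q S i)
      four refl = let (l , h) = third-bounds (q i) (0≤q i) (q≤½ i) in
        l , (λ { (s≤s (s≤s (s≤s ()))) }) , ℚₚ.≤-trans h (≤-const (+ 13 / 27) ½)

      by-size : ∣ L v ∣ ≡ 3 ⊎ L v ≡ ⊤ → Bounds (L v) (degree1 q (L v) i)
      by-size (inj₂ L≡⊤)  = four L≡⊤
      by-size (inj₁ size) with m , m∉L ← size≡3⇒missing (L v) size =
        subst (Bounds (L v)) (sym (degree1-three q (L v) i m size m∉L))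
          (ℚₚ.≤-trans (≤-const (+ 1 / 13) (+ 1 / 5)) 1/5≤ , (λ _ → 1/5≤) ,
           R.ratio₁≤ 0ℚ 0ℚ ½ (0≤q i) (0≤q m) (≤-const 0ℚ ½) (≤-const 1ℚ 1ℚ))
        where
        module R = Ratio₁ (q i) (q m) (0≤q m)
        1/5≤ = R.ratio₁≥ (q≤½ i) (q≤½ m)

    step-bounds : ∀ (G : Graph (suc n)) L v → Reachable G L v → ∀ i → Bounds (L v) (step ω p G L v i)
    step-bounds {n} G L v reach i = go n G L v reach (fixed G v) refl
      where
      -- `n` is bound again so that the case of two neighbors can refine it to a successor, as
      -- `Degree2` demands.
      go : ∀ n (G : Graph (suc n)) L v → Reachable G L v → ∀ us → fixed G v ≡ us → Bounds (L v) (step ω p G L v i)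
      go n G L v reach [] eq = subst (Bounds (L v)) (sym (step-nil p G L v i eq))
        (reciprocal-bounds (L v) (list-size G L v reach (subst (_↭ neighbors G v) eq (fixed-↭ G v))))
      go n G L v reach (v₁ ∷ []) eq = subst (Bounds (L v)) (sym (step-one p G L v i eq))
        (degree1-bounds G L v reach (subst (_↭ neighbors G v) eq (fixed-↭ G v)) i)
      go (suc n) G L v reach (a ∷ b ∷ []) eq =
        subst (Bounds (L v)) (sym (trans (step-two p G L v i eq) D.degree2≡ratio))
          (D.R.ratio≥ ,
           (λ ∣L∣≤3 → contradiction (subst (λ S → ∣ S ∣ ℕ.≤ 3) D.L≡⊤ ∣L∣≤3) λ { (s≤s (s≤s (s≤s ()))) }) ,
           D.R.ratio≤½)
        where
        module D = Degree2 p good G L v reach i (proj₁ (paired G L v i a b)) (proj₂ (paired G L v i a b))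
                     (pair-enumerates G L v i eq)
      go n G L v reach (_ ∷ _ ∷ _ ∷ _) eq =
        contradiction (subst (_↭ neighbors G v) eq (fixed-↭ G v)) (at-most-two G L v reach)

  bounded⇒Good : (p : Estimate) → (∀ {n} (G : Graph n) L v {i} → i ∉ L v → p G L v i ≡ 0ℚ) →
    (∀ {n} (G : Graph n) L v {i} → Reachable G L v → i ∈ L v → Bounds (L v) (p G L v i)) → Good p
  bounded⇒Good p off on = record
    { outside-list = off
    ; lower        = λ G L v reach i∈L → proj₁ (on G L v reach i∈L)
    ; lower₃       = λ G L v reach i∈L → proj₁ (proj₂ (on G L v reach i∈L))
    ; upper        = λ G L v i reach → upper′ G L v i reach (i ∈? L v)
    }
    where
    upper′ : ∀ {n} (G : Graph n) L v i → Reachable G L v → Dec (i ∈ L v) → p G L v i ℚ.≤ ½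
    upper′ G L v i reach (yes i∈L) = proj₂ (proj₂ (on G L v reach i∈L))
    upper′ G L v i reach (no  i∉L) = subst (ℚ._≤ ½) (sym (off G L v i∉L)) (≤-const 0ℚ ½)

  -- Depth 0 starts the induction because a reachable list has two to four colors, so the default
  -- 1/∣L(v)∣ already lies in [¼, ½].
  P-good : ∀ D → Good (Pᴰ D)
  P-good D = bounded⇒Good (Pᴰ D) (λ G L v → P-∉ G L v (+ D)) (on D)
    where
    on : ∀ D {n} (G : Graph n) L v {i} → Reachable G L v → i ∈ L v → Bounds (L v) (Pᴰ D G L v i)
    on zero G L v reach i∈L = subst (Bounds (L v)) (sym (P-zero G L v i∈L))
      (reciprocal-bounds (L v) (ℕₚ.≤-trans (ℕₚ.m≤n+m 2 (deg G v)) (proj₂ (proj₂ reach))))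
    on (suc D) {suc n} G L v {i} reach i∈L = subst (Bounds (L v)) (sym (P-suc G L v D i∈L))
      (step-bounds (Pᴰ D) (P-good D) G L v reach i)

-- Classification independent of the depth

-- The alternative is chosen before the depth. This order of quantifiers is what makes values at two
-- different depths comparable.
Classified : (ℕ → ℚ) → Set
Classified t = (∀ D → t D ≡ 0ℚ) ⊎ (∀ D → t D ≡ ½) ⊎ (∀ D → InInterval (t D))

classified-cong : ∀ {s t : ℕ → ℚ} → (∀ D → s D ≡ t D) → Classified t → Classified s
classified-cong s≡t (inj₁ z)        = inj₁ λ D → trans (s≡t D) (z D)
classified-cong s≡t (inj₂ (inj₁ h)) = inj₂ (inj₁ λ D → trans (s≡t D) (h D))
classified-cong s≡t (inj₂ (inj₂ b)) = inj₂ (inj₂ λ D → subst InInterval (sym (s≡t D)) (b D))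

reciprocal-classified : ∀ k → 2 ℕ.≤ k → k ℕ.≤ 4 → Classified (λ _ → 1ℚ ÷₀ fromℕ k)
reciprocal-classified 1 (s≤s ()) _
reciprocal-classified 2 _ _ = inj₂ (inj₁ λ _ → refl)
reciprocal-classified 3 _ _ = inj₂ (inj₂ λ _ → ≤-const (+ 1 / 13) (+ 1 / 3) , ≤-const (+ 1 / 3) (+ 13 / 27))
reciprocal-classified 4 _ _ = inj₂ (inj₂ λ _ → ≤-const (+ 1 / 13) (+ 1 / 4) , ≤-const (+ 1 / 4) (+ 13 / 27))
reciprocal-classified (suc (suc (suc (suc (suc _))))) _ (s≤s (s≤s (s≤s (s≤s ()))))

all-others∈ : ∀ S i → ∣ S ∣ ≡ 3 → i ∉ S → ∀ {j} → j ≢ i → j ∈ S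
all-others∈ S i size i∉S {j} j≢i =
  subst (j ∈_) (sym (missing⇒complement S i size i∉S)) (x∉p⇒x∈∁p (x≢y⇒x∉⁅y⁆ j≢i))

module Classification (ω : Ordering) where
  open Ordering ω
  open Recursion ω
  open EstimateBounds ω

  private
    fixed≡⇒enumerates : ∀ (G : Graph (suc n)) v {us} → fixed G v ≡ us → Enumerates G v us
    fixed≡⇒enumerates G v eq = subst (_↭ neighbors G v) eq (fixed-↭ G v)

  classify-one : ∀ (G : Graph (suc n)) L v {v₁} → Reachable G L v → Enumerates G v (v₁ ∷ []) → ∀ i →
    Classified (λ D → degree1 (Pᴰ (suc D) (delete G v) (restrict L v) v₁) (L v) i)
  classify-one G L v {v₁} reach e i = by-size (size-cases (L v) (list-size G L v reach e))
    where
    H  = delete G v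
    Lᵥ = restrict L v
    q : ℕ → Color → ℚ
    q D = Pᴰ (suc D) H Lᵥ v₁
    reach₁ : Reachable H Lᵥ v₁
    reach₁ = reachable-delete G L v reach v₁ (enumerates⁻ G v e (here refl))
    0≤q : ∀ D j → 0ℚ ℚ.≤ q D j
    0≤q D j = Good.nonneg (P-good (suc D)) H Lᵥ v₁ j reach₁
    q≤½ : ∀ D j → q D j ℚ.≤ ½
    q≤½ D j = Good.upper (P-good (suc D)) H Lᵥ v₁ j reach₁
    q≥ : ∀ D {j} → j ∈ Lᵥ v₁ → + 1 / 13 ℚ.≤ q D j
    q≥ D = Good.lower (P-good (suc D)) H Lᵥ v₁ reach₁

    four : ∀ {S} → S ≡ ⊤ → Classified (λ D → degree1 (q D) S i)
    four refl = inj₂ (inj₂ λ D → third-bounds (q D i) (0≤q D i) (q≤½ D i))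

    -- The ratio (1 - q_i) / (2 + q_m) is ½ when `v₁` lists neither `i` nor the color `m` missing at
    -- `v`. A listed `i` gives at most 6/13, a listed `m` at most 1 / (2 + 1/13), which is exactly
    -- the endpoint 13/27.
    three : ∀ m → Dec (i ∈ Lᵥ v₁) → Dec (m ∈ Lᵥ v₁) → Classified (λ D → (1ℚ - q D i) ÷₀ (fromℕ 2 + q D m))
    three m (yes i∈) _ = inj₂ (inj₂ λ D → let module R = Ratio₁ (q D i) (q D m) (0≤q D m) in
      ℚₚ.≤-trans (≤-const (+ 1 / 13) (+ 1 / 5)) (R.ratio₁≥ (q≤½ D i) (q≤½ D m)) ,
      R.ratio₁≤ (+ 1 / 13) 0ℚ (+ 13 / 27) (q≥ D i∈) (0≤q D m)
        (≤-const 0ℚ (+ 13 / 27)) (≤-const (1ℚ - + 1 / 13) (+ 13 / 27 * (fromℕ 2 + 0ℚ))))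
    three m (no _) (yes m∈) = inj₂ (inj₂ λ D → let module R = Ratio₁ (q D i) (q D m) (0≤q D m) in
      ℚₚ.≤-trans (≤-const (+ 1 / 13) (+ 1 / 5)) (R.ratio₁≥ (q≤½ D i) (q≤½ D m)) ,
      R.ratio₁≤ 0ℚ (+ 1 / 13) (+ 13 / 27) (0≤q D i) (q≥ D m∈)
        (≤-const 0ℚ (+ 13 / 27)) (≤-const (1ℚ - 0ℚ) (+ 13 / 27 * (fromℕ 2 + + 1 / 13))))
    three m (no i∉) (no m∉) = inj₂ (inj₁ λ D →
      cong₂ (λ x y → (1ℚ - x) ÷₀ (fromℕ 2 + y)) (P-∉ H Lᵥ v₁ (+ suc D) i∉) (P-∉ H Lᵥ v₁ (+ suc D) m∉))

    by-size : ∣ L v ∣ ≡ 3 ⊎ L v ≡ ⊤ → Classified (λ D → degree1 (q D) (L v) i)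
    by-size (inj₂ L≡⊤)  = four L≡⊤
    by-size (inj₁ size) with m , m∉L ← size≡3⇒missing (L v) size =
      classified-cong (λ D → degree1-three (q D) (L v) i m size m∉L) (three m (i ∈? Lᵥ v₁) (m ∈? Lᵥ v₁))

  module ClassifyTwo (G : Graph (suc (suc n))) (L : Lists (suc (suc n))) (v : Fin (suc (suc n)))
                     (reach : Reachable G L v) (i : Color) (v₁ v₂ : Fin (suc n))
                     (e : Enumerates G v (v₁ ∷ v₂ ∷ [])) (adm : Admissible G L v i v₁ v₂) where

    private
      module D2 (D : ℕ) = Degree2 (Pᴰ (suc D)) (P-good (suc D)) G L v reach i v₁ v₂ e
      open D2 0 using (H; Lᵥ; adj₁; adj₂; adjacent; strip-v₂; reach₂; x′; y′; z′)

      S₂ : Subset 4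
      S₂ = Lᵥ v₂

      interval : (∀ D → D2.R.ratio D ℚ.≤ + 13 / 27) → Classified (λ D → D2.R.ratio D)
      interval ratio≤ = inj₂ (inj₂ λ D → D2.R.ratio≥ D , ratio≤ D)

    module Absent (i∉₁ : i ∉ Lᵥ v₁) (i∉₂ : i ∉ S₂) where

      -- If `v₂` misses a second color, the vanishing y of that color is enough. Otherwise its list
      -- has exactly three colors and every other y is 1/3.
      isolated : fixed H v₂ ≡ [] → Classified (λ D → D2.R.ratio D)
      isolated eq = by-cases (x′ ∈? S₂) (y′ ∈? S₂) (z′ ∈? S₂)
        where
        y≡0 : ∀ D j → j ∉ S₂ → D2.y D j ℚ.≤ 0ℚ
        y≡0 D j j∉ = ℚₚ.≤-reflexive (P-∉ H (strip (v₁ ∷ []) j Lᵥ) v₂ (+ suc D) (j∉ ∘ subst (j ∈_) (strip-v₂ j)))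

        by-cases : Dec (x′ ∈ S₂) → Dec (y′ ∈ S₂) → Dec (z′ ∈ S₂) → Classified (λ D → D2.R.ratio D)
        by-cases (no x∉) _ _ = interval λ D → D2.R.ratio≤-excess D (D2.R.excess-one-x D (y≡0 D x′ x∉))
        by-cases (yes _) (no y∉) _ = interval λ D → D2.R.ratio≤-excess D (D2.R.excess-one-y D (y≡0 D y′ y∉))
        by-cases (yes _) (yes _) (no z∉) = interval λ D → D2.R.ratio≤-excess D (D2.R.excess-one-z D (y≡0 D z′ z∉))
        by-cases (yes x∈) (yes y∈) (yes z∈) = interval λ D →
          D2.R.ratio≤-excess D (D2.R.excess-all D (y≤ D x′ x∈) (y≤ D y′ y∈) (y≤ D z′ z∈))
          where
          size : ∣ S₂ ∣ ≡ 3
          size = trans (size-split S₂ i)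
            (cong₂ ℕ._+_ (member-∉ i∉₂) (cong₂ ℕ._+_ (member-∈ x∈) (cong₂ ℕ._+_ (member-∈ y∈) (member-∈ z∈))))
          y≤ : ∀ D j → j ∈ S₂ → D2.y D j ℚ.≤ + 6 / 13
          y≤ D j j∈ = subst (ℚ._≤ + 6 / 13) (sym (trans
            (P-suc H (strip (v₁ ∷ []) j Lᵥ) v₂ D (subst (j ∈_) (sym (strip-v₂ j)) j∈))
            (trans (step-nil (Pᴰ D) H (strip (v₁ ∷ []) j Lᵥ) v₂ j eq)
              (cong (λ k → 1ℚ ÷₀ fromℕ k) (trans (cong ∣_∣ (strip-v₂ j)) size)))))
            (≤-const (1ℚ ÷₀ fromℕ 3) (+ 6 / 13))

      x≢ : x′ ≢ i
      x≢ = punchInᵢ≢i i 0F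

      y≢ : y′ ≢ i
      y≢ = punchInᵢ≢i i 1F

      z≢ : z′ ≢ i
      z≢ = punchInᵢ≢i i 2F

      -- w is the only neighbor of v₂ besides v, hence v₂ lists all colors but i.
      module Pendant (w : Fin n) (eq : fixed H v₂ ≡ w ∷ []) where

        private
          e₂ : Enumerates H v₂ (w ∷ [])
          e₂ = fixed≡⇒enumerates H v₂ eq

          adj-w : T (adj H v₂ (punchIn v₂ w))
          adj-w = enumerates⁻ H v₂ e₂ (here refl)

          size₂ : ∣ S₂ ∣ ≡ 3
          size₂ = ℕₚ.≤-antisym (∉⇒size≤3 S₂ i∉₂)
            (list-size H Lᵥ v₂ (reachable-delete G L v reach v₂ adj₂) e₂)

          H₂ = delete H v₂

          Lⱼ : Color → Lists n
          Lⱼ j = restrict (strip (v₁ ∷ []) j Lᵥ) v₂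

          q : ℕ → Color → Color → ℚ
          q D j = Pᴰ D H₂ (Lⱼ j) w

          y≡ : ∀ D j → j ≢ i → D2.y D j ≡ (1ℚ - q D j j) ÷₀ (fromℕ 2 + q D j i)
          y≡ D j j≢i = trans (P-suc H L′ v₂ D (subst (j ∈_) (sym (strip-v₂ j)) (all-others∈ S₂ i size₂ i∉₂ j≢i)))
            (trans (step-one (Pᴰ D) H L′ v₂ j eq)
              (degree1-three (q D j) (L′ v₂) j i (trans (cong ∣_∣ (strip-v₂ j)) size₂)
                (i∉₂ ∘ subst (i ∈_) (strip-v₂ j))))
            where
            L′ = strip (v₁ ∷ []) j Lᵥ

          reach-w : ∀ j → Reachable H₂ (Lⱼ j) w
          reach-w j = reachable-delete H (strip (v₁ ∷ []) j Lᵥ) v₂ (reach₂ j) w adj-w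

        -- Here `w` is `v₁`, whose list lacks `i` and has just been stripped of `j`. Both arguments
        -- of the degree-1 ratio are therefore 0 at every depth, and each y is exactly ½.
        triangle : punchIn v₂ w ≡ v₁ → Classified (λ D → D2.R.ratio D)
        triangle w≡v₁ = inj₂ (inj₁ λ D → D2.R.ratio≡½ D (D2.F.off D i∉₁)
          (P-∉ H (strip (v₁ ∷ []) i Lᵥ) v₂ (+ suc D) (i∉₂ ∘ subst (i ∈_) (strip-v₂ i)))
          (y≡½ D x′ x≢) (y≡½ D y′ y≢) (y≡½ D z′ z≢))
          where
          list-w : ∀ j → Lⱼ j w ≡ Lᵥ v₁ ∖ j
          list-w j = trans (cong (strip (v₁ ∷ []) j Lᵥ) w≡v₁) (strip-∈ Lᵥ (v₁ ∷ []) j v₁ (here refl))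

          y≡½ : ∀ D j → j ≢ i → D2.y D j ≡ ½
          y≡½ D j j≢i = trans (y≡ D j j≢i) (cong₂ (λ x y → (1ℚ - x) ÷₀ (fromℕ 2 + y))
            (P-∉ H₂ (Lⱼ j) w (+ D) (x∉p∖x (Lᵥ v₁) j ∘ subst (j ∈_) (list-w j)))
            (P-∉ H₂ (Lⱼ j) w (+ D) (i∉₁ ∘ p─q⊆p (Lᵥ v₁) ⁅ j ⁆ ∘ subst (i ∈_) (list-w j))))

        -- Now `w` keeps its list `S`. If `S` contains `i`, the denominators 2 + q_i grow for every
        -- `j`; if not, the numerators 1 - q_j shrink for the colors `j` of `S`, of which there are
        -- at least two.
        no-triangle : punchIn v₂ w ≢ v₁ → Classified (λ D → D2.R.ratio D)
        no-triangle w≢v₁ = by-cases (i ∈? S) (∣ S ∣ ℕₚ.≤? 3)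
          where
          S : Subset 4
          S = Lᵥ (punchIn v₂ w)

          list-w : ∀ j → Lⱼ j w ≡ S
          list-w j = strip-∉ Lᵥ (v₁ ∷ []) j (punchIn v₂ w) λ { (here w≡v₁) → w≢v₁ w≡v₁ }

          0≤q : ∀ D j k → 0ℚ ℚ.≤ q D j k
          0≤q D j k = Good.nonneg (P-good D) H₂ (Lⱼ j) w k (reach-w j)

          q≥1/13 : ∀ D j {k} → k ∈ S → + 1 / 13 ℚ.≤ q D j k
          q≥1/13 D j {k} k∈ = Good.lower (P-good D) H₂ (Lⱼ j) w (reach-w j) (subst (k ∈_) (sym (list-w j)) k∈)

          q≥1/5 : ∣ S ∣ ℕ.≤ 3 → ∀ D j {k} → k ∈ S → + 1 / 5 ℚ.≤ q D j k
          q≥1/5 ∣S∣≤3 D j {k} k∈ = Good.lower₃ (P-good D) H₂ (Lⱼ j) w (reach-w j)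
            (subst (k ∈_) (sym (list-w j)) k∈) (subst (λ S → ∣ S ∣ ℕ.≤ 3) (sym (list-w j)) ∣S∣≤3)

          y≤ : ∀ D j → j ≢ i → ∀ a b r → a ℚ.≤ q D j j → b ℚ.≤ q D j i →
               0ℚ ℚ.≤ r → 1ℚ - a ℚ.≤ r * (fromℕ 2 + b) → D2.y D j ℚ.≤ r
          y≤ D j j≢i a b r a≤ b≤ 0≤r h = subst (ℚ._≤ r) (sym (y≡ D j j≢i))
            (Ratio₁.ratio₁≤ (q D j j) (q D j i) (0≤q D j i) a b r a≤ b≤ 0≤r h)

          all : (∀ D j → j ≢ i → D2.y D j ℚ.≤ + 6 / 13) → Classified (λ D → D2.R.ratio D)
          all h = interval λ D → D2.R.ratio≤-excess D (D2.R.excess-all D (h D x′ x≢) (h D y′ y≢) (h D z′ z≢))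

          by-cases : Dec (i ∈ S) → Dec (∣ S ∣ ℕ.≤ 3) → Classified (λ D → D2.R.ratio D)
          -- 1 / (2 + 1/5) = 5/11 is below 6/13; the general bound 1/13 would only give 13/27.
          by-cases (yes i∈) (yes ∣S∣≤3) = all λ D j j≢i →
            y≤ D j j≢i 0ℚ (+ 1 / 5) (+ 6 / 13) (0≤q D j j) (q≥1/5 ∣S∣≤3 D j i∈)
              (≤-const 0ℚ (+ 6 / 13)) (≤-const (1ℚ - 0ℚ) (+ 6 / 13 * (fromℕ 2 + + 1 / 5)))
          by-cases (yes i∈) (no ∣S∣≰3) = all λ D j j≢i →
            y≤ D j j≢i (+ 1 / 13) (+ 1 / 13) (+ 6 / 13) (q≥1/13 D j (subst (j ∈_) (sym S≡⊤) ∈⊤)) (q≥1/13 D j i∈)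
              (≤-const 0ℚ (+ 6 / 13)) (≤-const (1ℚ - + 1 / 13) (+ 6 / 13 * (fromℕ 2 + + 1 / 13)))
            where
            S≡⊤ : S ≡ ⊤
            S≡⊤ = ∣p∣≡n⇒p≡⊤ (ℕₚ.≤-antisym (∣p∣≤n S) (ℕₚ.≰⇒> ∣S∣≰3))
          by-cases (no i∉) _ = two (two-of-three S i i∉ 2≤∣S∣)
            where
            2≤∣S∣ : 2 ℕ.≤ ∣ S ∣
            2≤∣S∣ = ℕₚ.≤-trans (ℕₚ.m≤n+m 2 (deg H₂ w))
              (subst (λ S → deg H₂ w ℕ.+ 2 ℕ.≤ ∣ S ∣) (list-w i) (proj₂ (proj₂ (reach-w i))))

            -- Missing `i`, the list `S` has at most three colors, so 1/5 applies and (1 - 1/5) / 2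
            -- = 2/5.
            h : ∀ D j → j ≢ i → j ∈ S → D2.y D j ℚ.≤ + 2 / 5
            h D j j≢i j∈ = y≤ D j j≢i (+ 1 / 5) 0ℚ (+ 2 / 5) (q≥1/5 (∉⇒size≤3 S i∉) D j j∈) (0≤q D j i)
              (≤-const 0ℚ (+ 2 / 5)) (≤-const (1ℚ - + 1 / 5) (+ 2 / 5 * (fromℕ 2 + 0ℚ)))

            two : (x′ ∈ S × y′ ∈ S) ⊎ (x′ ∈ S × z′ ∈ S) ⊎ (y′ ∈ S × z′ ∈ S) → Classified (λ D → D2.R.ratio D)
            two (inj₁ (x∈ , y∈)) = interval λ D →
              D2.R.ratio≤-excess D (D2.R.excess-two-xy D (h D x′ x≢ x∈) (h D y′ y≢ y∈))
            two (inj₂ (inj₁ (x∈ , z∈))) = interval λ D →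
              D2.R.ratio≤-excess D (D2.R.excess-two-xz D (h D x′ x≢ x∈) (h D z′ z≢ z∈))
            two (inj₂ (inj₂ (y∈ , z∈))) = interval λ D →
              D2.R.ratio≤-excess D (D2.R.excess-two-yz D (h D y′ y≢ y∈) (h D z′ z≢ z∈))

      -- This is where the order of the two neighbors matters: a `v₂` of degree 3 forces `v₁` to
      -- have degree at least 3, hence four colors, contradicting that `i` is absent there.
      crowded : ∀ {a b us} → fixed H v₂ ≢ a ∷ b ∷ us
      crowded {us = us} eq = contradiction (ℕₚ.≤-trans 4≤ (∉⇒size≤3 (Lᵥ v₁) i∉₁)) λ { (s≤s (s≤s (s≤s ()))) }
        where
        3≤deg₂ : 3 ℕ.≤ deg G (punchIn v v₂)
        3≤deg₂ = subst (3 ℕ.≤_) (sym (trans (deg-neighbor G v v₂ adj₂)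
          (cong suc (sym (length-enumerates H v₂ (fixed≡⇒enumerates H v₂ eq)))))) (s≤s (s≤s (s≤s z≤n)))
        4≤ : 4 ℕ.≤ ∣ Lᵥ v₁ ∣
        4≤ = ℕₚ.≤-trans (ℕₚ.+-monoˡ-≤ 1 (ℕₚ.≤-trans 3≤deg₂ (proj₁ adm))) (proj₂ (proj₁ reach (punchIn v v₁)))

      absent : ∀ us → fixed H v₂ ≡ us → Classified (λ D → D2.R.ratio D)
      absent []          eq = isolated eq
      absent (w ∷ [])    eq = by-cases (punchIn v₂ w ≟F v₁)
        where
        by-cases : Dec (punchIn v₂ w ≡ v₁) → Classified (λ D → D2.R.ratio D)
        by-cases (yes w≡v₁) = Pendant.triangle w eq w≡v₁
        by-cases (no  w≢v₁) = Pendant.no-triangle w eq w≢v₁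
      absent (_ ∷ _ ∷ _) eq = contradiction eq crowded

    classify-two : Classified (λ D → degree2 ω (Pᴰ (suc D)) G L v i v₁ v₂)
    classify-two = classified-cong (λ D → D2.degree2≡ratio D) (by-cases (i ∈? Lᵥ v₁) (i ∈? S₂))
      where
      by-cases : Dec (i ∈ Lᵥ v₁) → Dec (i ∈ S₂) → Classified (λ D → D2.R.ratio D)
      by-cases (yes i∈) _       = interval λ D → D2.ratio≤-∈₁ D i∈
      by-cases (no _) (yes i∈)  = interval λ D → D2.ratio≤-∈₂ D i∈
      by-cases (no i∉₁) (no i∉₂) = Absent.absent i∉₁ i∉₂ (fixed H v₂) refl

  classify : ∀ (G : Graph n) L v → Reachable G L v → ∀ i → Classified (λ D → Pᴰ (suc (suc D)) G L v i)
  classify {suc n} G L v reach i = by-list (i ∈? L v)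
    where
    go : ∀ n (G : Graph (suc n)) L v → Reachable G L v → ∀ us → fixed G v ≡ us →
         Classified (λ D → step ω (Pᴰ (suc D)) G L v i)
    go n G L v reach [] eq = classified-cong (λ D → step-nil (Pᴰ (suc D)) G L v i eq)
      (reciprocal-classified ∣ L v ∣ (list-size G L v reach (fixed≡⇒enumerates G v eq)) (∣p∣≤n (L v)))
    go n G L v reach (v₁ ∷ []) eq = classified-cong (λ D → step-one (Pᴰ (suc D)) G L v i eq)
      (classify-one G L v reach (fixed≡⇒enumerates G v eq) i)
    go (suc n) G L v reach (a ∷ b ∷ []) eq = classified-cong (λ D → step-two (Pᴰ (suc D)) G L v i eq)
      (ClassifyTwo.classify-two G L v reach i (proj₁ (paired G L v i a b)) (proj₂ (paired G L v i a b))
        (pair-enumerates G L v i eq) (paired-admissible G L v i a b eq))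
    go n G L v reach (_ ∷ _ ∷ _ ∷ _) eq =
      contradiction (fixed≡⇒enumerates G v eq) (at-most-two G L v reach)

    by-list : Dec (i ∈ L v) → Classified (λ D → Pᴰ (suc (suc D)) G L v i)
    by-list (no  i∉) = inj₁ λ D → P-∉ G L v (+ suc (suc D)) i∉
    by-list (yes i∈) = classified-cong (λ D → P-suc G L v (suc D) i∈) (go n G L v reach (fixed G v) refl)

-- Exactness at sufficient depth

record Marginal (r : Estimate) : Set where
  field
    off       : ∀ {n} (G : Graph n) L v {j} → j ∉ L v → r G L v j ≡ 0ℚ
    total     : ∀ {n} (G : Graph n) L v → Valid G L → ∑ ⊤ (r G L v) ≡ 1ℚ
    recursion : ∀ {n} (G : Graph (suc n)) L v → Valid G L → ∀ us → Enumerates G v us → ∀ {i} → i ∈ L v →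
      r G L v i ≡ survivalAlong r (delete G v) (restrict L v) i us ÷₀
                  ∑ (L v) (λ j → survivalAlong r (delete G v) (restrict L v) j us)

Pr-marginal : Marginal Pr
Pr-marginal = record { off = Pr-∉ ; total = ∑-Pr ; recursion = Pr-recursion }

-- r stands for Pr; keeping it abstract prevents the type checker from
-- unfolding Pr to the enumeration of all colorings.
module _ (r : Estimate) (marginal : Marginal r) where

  open Marginal marginal

  Exact : Estimate → ℕ → Set
  Exact p n = ∀ (G : Graph n) L v → Reachable G L v → ∀ i → p G L v i ≡ r G L v i

  module _ (p : Estimate) (H : Graph (suc n)) (L : Lists (suc n)) (v₁ : Fin (suc n))
           (exact : Exact p n) (reach : Reachable H L v₁) where

    private
      H′ = delete H v₁
      L′ = restrict L v₁

      factor : ∀ (pre : List (Fin n)) → (∀ {u} → u ∈ᴸ pre → T (adj H v₁ (punchIn v₁ u))) →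
               ∀ u → T (adj H v₁ (punchIn v₁ u)) → u ∉ᴸ pre → ∀ w →
               1ℚ - p H′ (strip pre w L′) u w ≡ 1ℚ - r H′ (strip pre w L′) u w
      factor pre adjacent u a u∉pre w = cong (λ t → 1ℚ - t)
        (exact H′ (strip pre w L′) u (reachable-strip H L v₁ (proj₁ reach) w pre adjacent u a u∉pre) w)

    survivalAlong-exact : ∀ us → Enumerates H v₁ us → ∀ w → survivalAlong p H′ L′ w us ≡ survivalAlong r H′ L′ w us
    survivalAlong-exact [] e w = refl
    survivalAlong-exact (u ∷ []) e w =
      cong (_* 1ℚ) (factor [] (λ ()) u (enumerates⁻ H v₁ e (here refl)) (λ ()) w)
    survivalAlong-exact (u ∷ u′ ∷ []) e w = cong₂ (λ a b → a * (b * 1ℚ))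
      (factor [] (λ ()) u (enumerates⁻ H v₁ e (here refl)) (λ ()) w)
      (factor (u ∷ []) adjacent u′ (enumerates⁻ H v₁ e (there (here refl))) fresh w)
      where
      adjacent : ∀ {x} → x ∈ᴸ u ∷ [] → T (adj H v₁ (punchIn v₁ x))
      adjacent (here refl) = enumerates⁻ H v₁ e (here refl)
      fresh : u′ ∉ᴸ u ∷ []
      fresh (here u′≡u) = enumerates-distinct H v₁ e u′≡u
    survivalAlong-exact (_ ∷ _ ∷ _ ∷ us) e w = contradiction e (at-most-two H L v₁ reach)

  module Exactness (ω : Ordering) where
    open Ordering ω
    open Recursion ω
    open EstimateBounds ω

    private
      -- `f₂` carries out the recursion at `v₁` in place, so it consults estimates on graphs with
      -- two vertices fewer, whereas `y₂` consults those with one fewer.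
      f₂-exact : ∀ (p : Estimate) (G : Graph (suc (suc n))) L v i v₁ v₂ → Exact p n →
        Reachable (delete G v) (restrict L v) v₁ → ∀ j → f₂ p G L v i v₁ v₂ j ≡ r (delete G v) (restrict L v) v₁ j
      f₂-exact p G L v i v₁ v₂ exact reach j = by-cases (j ∈? S)
        where
        H  = delete G v
        Lᵥ = restrict L v
        S  = Lᵥ v₁
        s s′ : Color → ℚ
        s  = survival ω p H Lᵥ v₁
        s′ w = survivalAlong r (delete H v₁) (restrict Lᵥ v₁) w (fixed H v₁)
        s≡s′ : ∀ w → s w ≡ s′ w
        s≡s′ = survivalAlong-exact p H Lᵥ v₁ exact reach (fixed H v₁) (fixed-↭ H v₁)
        by-cases : Dec (j ∈ S) → mask S s j ÷₀ ∑ S s ≡ r H Lᵥ v₁ j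
        by-cases (yes j∈) = trans (cong₂ _÷₀_ (trans (mask-∈ S s j∈) (s≡s′ j)) (∑-cong S (λ {w} _ → s≡s′ w)))
          (sym (recursion H Lᵥ v₁ (proj₁ reach) (fixed H v₁) (fixed-↭ H v₁) j∈))
        by-cases (no j∉) = trans (trans (cong (_÷₀ ∑ S s) (mask-∉ S s j∉)) (0÷₀ (∑ S s))) (sym (off H Lᵥ v₁ j∉))

      -- The denominators 3 and 2 + q m of `degree1` are the sum in the recursion after using that
      -- the marginals at `v₁` add up to 1.
      degree1-exact : ∀ (p : Estimate) (G : Graph (suc n)) L v {v₁} → Exact p n → Reachable G L v →
        Enumerates G v (v₁ ∷ []) → ∀ {i} → i ∈ L v →
        degree1 (p (delete G v) (restrict L v) v₁) (L v) i ≡ r G L v i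
      degree1-exact p G L v {v₁} exact reach e {i} i∈L =
        trans (by-size (size-cases (L v) (list-size G L v reach e)))
          (sym (recursion G L v (proj₁ reach) (v₁ ∷ []) e i∈L))
        where
        H  = delete G v
        Lᵥ = restrict L v
        q t : Color → ℚ
        q = p H Lᵥ v₁
        t = r H Lᵥ v₁
        reach₁ : Reachable H Lᵥ v₁
        reach₁ = reachable-delete G L v reach v₁ (enumerates⁻ G v e (here refl))
        q≡t : ∀ j → q j ≡ t j
        q≡t j = exact H Lᵥ v₁ reach₁ j
        ∑t≡1 : ∑ ⊤ t ≡ 1ℚ
        ∑t≡1 = total H Lᵥ v₁ (proj₁ reach₁)
        numerator : 1ℚ - q i ≡ (1ℚ - t i) * 1ℚ
        numerator = trans (cong (λ a → 1ℚ - a) (q≡t i)) (sym (ℚₚ.*-identityʳ (1ℚ - t i)))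

        four : ∀ {S} → S ≡ ⊤ → degree1 q S i ≡ ((1ℚ - t i) * 1ℚ) ÷₀ ∑ S (λ j → (1ℚ - t j) * 1ℚ)
        four refl = cong₂ _÷₀_ numerator (sym (∑-four t ∑t≡1))

        by-size : ∣ L v ∣ ≡ 3 ⊎ L v ≡ ⊤ → degree1 q (L v) i ≡ ((1ℚ - t i) * 1ℚ) ÷₀ ∑ (L v) (λ j → (1ℚ - t j) * 1ℚ)
        by-size (inj₂ L≡⊤)  = four L≡⊤
        by-size (inj₁ size) with m , m∉L ← size≡3⇒missing (L v) size =
          trans (degree1-three q (L v) i m size m∉L) (cong₂ _÷₀_ numerator
            (trans (cong (λ a → fromℕ 2 + a) (q≡t m)) (sym (∑-three t (L v) m size m∉L ∑t≡1))))

      degree2-exact : ∀ (p : Estimate) (G : Graph (suc (suc n))) L v i v₁ v₂ → Exact p n → Exact p (suc n) →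
        Reachable G L v → Enumerates G v (v₁ ∷ v₂ ∷ []) → i ∈ L v → degree2 ω p G L v i v₁ v₂ ≡ r G L v i
      degree2-exact p G L v i v₁ v₂ exact₀ exact₁ reach e i∈L =
        trans (degree2≡ p G L v i v₁ v₂)
          (trans (cong₂ _÷₀_ (term≡ i) (∑-cong (L v) (λ {j} _ → term≡ j)))
            (sym (recursion G L v (proj₁ reach) (v₁ ∷ v₂ ∷ []) e i∈L)))
        where
        H  = delete G v
        Lᵥ = restrict L v
        adjacent : ∀ {u} → u ∈ᴸ v₁ ∷ [] → T (adj G v (punchIn v u))
        adjacent (here refl) = enumerates⁻ G v e (here refl)
        fresh : v₂ ∉ᴸ v₁ ∷ []
        fresh (here v₂≡v₁) = enumerates-distinct G v e v₂≡v₁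
        term≡ : ∀ j → (1ℚ - f₂ p G L v i v₁ v₂ j) * (1ℚ - y₂ p G L v i v₁ v₂ j) ≡
                      (1ℚ - r H Lᵥ v₁ j) * ((1ℚ - r H (strip (v₁ ∷ []) j Lᵥ) v₂ j) * 1ℚ)
        term≡ j = cong₂ (λ a b → (1ℚ - a) * b)
          (f₂-exact p G L v i v₁ v₂ exact₀ (reachable-delete G L v reach v₁ (enumerates⁻ G v e (here refl))) j)
          (trans (cong (λ t → 1ℚ - t) (exact₁ H (strip (v₁ ∷ []) j Lᵥ) v₂
                   (reachable-strip G L v (proj₁ reach) j (v₁ ∷ []) adjacent v₂ (enumerates⁻ G v e (there (here refl))) fresh) j))
            (sym (ℚₚ.*-identityʳ (1ℚ - r H (strip (v₁ ∷ []) j Lᵥ) v₂ j))))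

    P-exact : ∀ D n → n ℕ.≤ D → Exact (Pᴰ D) n
    P-exact D       zero    n≤D       G L ()
    P-exact (suc D) (suc n) (s≤s n≤D) G L v reach i = by-list (i ∈? L v)
      where
      go : ∀ n → n ℕ.≤ D → (G : Graph (suc n)) → ∀ L v → Reachable G L v → ∀ us → fixed G v ≡ us → i ∈ L v →
           step ω (Pᴰ D) G L v i ≡ r G L v i
      go n n≤D G L v reach [] eq i∈L = trans (step-nil (Pᴰ D) G L v i eq)
        (trans (cong (1ℚ ÷₀_) (sym (∑-one (L v))))
          (sym (recursion G L v (proj₁ reach) [] (subst (_↭ neighbors G v) eq (fixed-↭ G v)) i∈L)))
      go n n≤D G L v reach (v₁ ∷ []) eq i∈L = trans (step-one (Pᴰ D) G L v i eq)
        (degree1-exact (Pᴰ D) G L v (P-exact D n n≤D) reach (subst (_↭ neighbors G v) eq (fixed-↭ G v)) i∈L)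
      go (suc n) n≤D G L v reach (a ∷ b ∷ []) eq i∈L = trans (step-two (Pᴰ D) G L v i eq)
        (degree2-exact (Pᴰ D) G L v i (proj₁ (paired G L v i a b)) (proj₂ (paired G L v i a b))
          -- Removing two vertices costs a single level of depth, so both instances of exactness
          -- hold at the same `D`.
          (P-exact D n (ℕₚ.<⇒≤ n≤D)) (P-exact D (suc n) n≤D) reach (pair-enumerates G L v i eq) i∈L)
      go n n≤D G L v reach (_ ∷ _ ∷ _ ∷ _) eq i∈L =
        contradiction (subst (_↭ neighbors G v) eq (fixed-↭ G v)) (at-most-two G L v reach)

      by-list : Dec (i ∈ L v) → Pᴰ (suc D) G L v i ≡ r G L v i
      by-list (no  i∉L) = trans (P-∉ G L v (+ suc D) i∉L) (sym (off G L v i∉L))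
      by-list (yes i∈L) = trans (P-suc G L v D i∈L) (go n n≤D G L v reach (fixed G v) refl i∈L)

-- Disjointness of the classes and conclusion

0∉interval : ¬ InInterval 0ℚ
0∉interval (1/13≤0 , _) = contradiction 1/13≤0 (toWitnessFalse {a? = + 1 / 13 ℚₚ.≤? 0ℚ} _)

½∉interval : ¬ InInterval ½
½∉interval (_ , ½≤13/27) = contradiction ½≤13/27 (toWitnessFalse {a? = ½ ℚₚ.≤? + 13 / 27} _)

-- The three classes are pairwise disjoint, so the common class of all values makes one equivalence
-- hold with both sides true and the other two with both sides false.
classified⇒⇔ : ∀ {t} → Classified t → ∀ D E →
  (t D ≡ 0ℚ ⇔ t E ≡ 0ℚ) × (t D ≡ ½ ⇔ t E ≡ ½) × (InInterval (t D) ⇔ InInterval (t E))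
classified⇒⇔ {t} (inj₁ z) D E =
  mk⇔ (λ _ → z E) (λ _ → z D) ,
  mk⇔ (λ h → contradiction (trans (sym (z D)) h) λ ()) (λ h → contradiction (trans (sym (z E)) h) λ ()) ,
  mk⇔ (λ b → contradiction (subst InInterval (z D) b) 0∉interval) (λ b → contradiction (subst InInterval (z E) b) 0∉interval)
classified⇒⇔ {t} (inj₂ (inj₁ h)) D E =
  mk⇔ (λ z → contradiction (trans (sym (h D)) z) λ ()) (λ z → contradiction (trans (sym (h E)) z) λ ()) ,
  mk⇔ (λ _ → h E) (λ _ → h D) ,
  mk⇔ (λ b → contradiction (subst InInterval (h D) b) ½∉interval) (λ b → contradiction (subst InInterval (h E) b) ½∉interval)
classified⇒⇔ {t} (inj₂ (inj₂ b)) D E =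
  mk⇔ (λ z → contradiction (subst InInterval z (b D)) 0∉interval) (λ z → contradiction (subst InInterval z (b E)) 0∉interval) ,
  mk⇔ (λ h → contradiction (subst InInterval h (b D)) ½∉interval) (λ h → contradiction (subst InInterval h (b E)) ½∉interval) ,
  mk⇔ (λ _ → b E) (λ _ → b D)

theorem12 : (ω : Ordering) {n : ℕ} (G : Graph n) (L : Lists n) (v : Fin n) →
    Reachable G L v → (i : Color) (D : ℤ) → + 2 ≤ D →
    (P ω G L v i D ≡ 0ℚ ⇔ Pr G L v i ≡ 0ℚ) ×
    (P ω G L v i D ≡ ½ ⇔ Pr G L v i ≡ ½) ×
    (InInterval (P ω G L v i D) ⇔ InInterval (Pr G L v i))
theorem12 ω {n} G L v reach i (+ suc (suc D)) (+≤+ (s≤s (s≤s z≤n))) =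
  subst (λ t → (P ω G L v i (+ suc (suc D)) ≡ 0ℚ ⇔ t ≡ 0ℚ) × (P ω G L v i (+ suc (suc D)) ≡ ½ ⇔ t ≡ ½) ×
               (InInterval (P ω G L v i (+ suc (suc D))) ⇔ InInterval t))
    -- The second depth is 2 + n: it is of the form covered by the classification and at least the
    -- number `n` of vertices, so the value there is `Pr`.
    (Exactness.P-exact Pr Pr-marginal ω (suc (suc n)) n (ℕₚ.m≤n+m n 2) G L v reach i)
    (classified⇒⇔ (Classification.classify ω G L v reach i) D n)
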